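{- Let $k \geq 2$ be an integer, let $F_n^{(k)}$ denote the $n$-th $k$-generalized Fibonacci number, and let $\alpha_1, \dots, \alpha_k$ be the (complex) roots of $x^k - x^{k-1} - \cdots - x - 1 = 0$. Then for all integers $n \geq 2-k$, $$F_n^{(k)} = \sum_{i=1}^k \frac{\alpha_i - 1}{2 + (k+1)(\alpha_i - 2)}\, \alpha_i^{n-1}.$$
   Context: For an integer $k \geq 2$, the $k$-generalized Fibonacci numbers $F_n^{(k)}$ (for integers $n \geq 2-k$) are defined by the $k$ initial values $F_n^{(k)} = 0$ for $2-k \leq n \leq 0$ and $F_1^{(k)} = 1$, together with the recurrence $F_n^{(k)} = F_{n-1}^{(k)} + F_{n-2}^{(k)} + \cdots + F_{n-k}^{(k)}$ for all $n \geq 2$. -}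

module Defs where

open import Algebra.Bundles using (CommutativeRing; AbelianGroup)
import Algebra.Construct.DirectProduct as DirectProduct
import Algebra.Definitions
import Algebra.Properties.CommutativeMonoid.Sum
import Algebra.Properties.Monoid.Mult
import Algebra.Properties.Semiring.Exp
open import Data.Fin.Base using (Fin; toℕ)
open import Data.Integer.Base as ℤ using (ℤ; +_; -[1+_])
import Data.Integer.Properties as ℤ
open import Data.Nat.Base as ℕ using (ℕ; zero; suc)
import Data.Nat.Properties as ℕ
open import Data.Product.Base using (∃-syntax; _×_; _,_; proj₁; proj₂)
open import Data.Rational.Base as ℚ using (ℚ; 0ℚ; 1ℚ; ½; Positive)
import Data.Rational.Base
import Data.Rational.Properties as ℚ
open import Data.Rational.Solver using (module +-*-Solver)
open import Level using (0ℓ)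
open import Relation.Binary.PropositionalEquality.Core as ≡ using (_≡_; cong)

-- `x ∼ y` says that x m - y n tends to 0 as m and n tend to infinity
-- independently.  Hence `x ∼ x` is the Cauchy condition, and between
-- Cauchy sequences `_∼_` is the usual equality of limits.

infix 4 _∼_

_∼_ : (x y : ℕ → ℚ) → Set
x ∼ y = ∀ ε → .{{Positive ε}} →
        ∃[ N ] (∀ m n → N ℕ.≤ m → N ℕ.≤ n → ℚ.∣ x m ℚ.- y n ∣ ℚ.< ε)

record ℝ : Set where
  constructor real
  field
    seq    : ℕ → ℚ
    cauchy : seq ∼ seq

open ℝ public

infix 4 _≈ᴿ_

_≈ᴿ_ : ℝ → ℝ → Set
x ≈ᴿ y = seq x ∼ seq y

private
  half-pos : ∀ ε → .{{Positive ε}} → Positive (ε ℚ.* ½)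
  half-pos ε = ℚ.pos*pos⇒pos ε ½

  halves : ∀ ε → ε ℚ.* ½ ℚ.+ ε ℚ.* ½ ≡ ε
  halves ε = ≡.trans (≡.sym (ℚ.*-distribˡ-+ ε ½ ½)) (ℚ.*-identityʳ ε)

  ∣-∣-split : ∀ {ε} p q {r} → r ≡ p ℚ.+ q →
              ℚ.∣ p ∣ ℚ.< ε ℚ.* ½ → ℚ.∣ q ∣ ℚ.< ε ℚ.* ½ → ℚ.∣ r ∣ ℚ.< ε
  ∣-∣-split {ε} p q ≡.refl p< q< = begin-strict
    ℚ.∣ p ℚ.+ q ∣           ≤⟨ ℚ.∣p+q∣≤∣p∣+∣q∣ p q ⟩
    ℚ.∣ p ∣ ℚ.+ ℚ.∣ q ∣     <⟨ ℚ.+-mono-< p< q< ⟩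
    ε ℚ.* ½ ℚ.+ ε ℚ.* ½     ≡⟨ halves ε ⟩
    ε                       ∎
    where open ℚ.≤-Reasoning

  ∣-∣-* : ∀ δ B .{{_ : Positive B}} p q →
          ℚ.∣ p ∣ ℚ.< δ → ℚ.∣ q ∣ ℚ.< B → ℚ.∣ p ℚ.* q ∣ ℚ.< δ ℚ.* B
  ∣-∣-* δ B p q p< q< = begin-strict
    ℚ.∣ p ℚ.* q ∣         ≡⟨ ℚ.∣p*q∣≡∣p∣*∣q∣ p q ⟩
    ℚ.∣ p ∣ ℚ.* ℚ.∣ q ∣   ≤⟨ ℚ.*-monoˡ-≤-nonNeg ℚ.∣ p ∣ {{ℚ.∣-∣-nonNeg p}} (ℚ.<⇒≤ q<) ⟩
    ℚ.∣ p ∣ ℚ.* B         <⟨ ℚ.*-monoˡ-<-pos B p< ⟩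
    δ ℚ.* B               ∎
    where open ℚ.≤-Reasoning

∼-sym : ∀ {x y} → x ∼ y → y ∼ x
∼-sym {x} {y} x∼y ε with N , h ← x∼y ε = N , λ m n N≤m N≤n →
  ≡.subst (ℚ._< ε) (flip-∣-∣ (x n) (y m)) (h n m N≤n N≤m)
  where
  open +-*-Solver
  flip-∣-∣ : ∀ p q → ℚ.∣ p ℚ.- q ∣ ≡ ℚ.∣ q ℚ.- p ∣
  flip-∣-∣ p q = ≡.trans (≡.sym (ℚ.∣-p∣≡∣p∣ (p ℚ.- q))) (cong ℚ.∣_∣
    (solve 2 (λ p q → :- (p :- q) := q :- p) ≡.refl p q))

∼-trans : ∀ {x y z} → x ∼ y → y ∼ z → x ∼ z
∼-trans {x} {y} {z} x∼y y∼z ε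
  with N , h ← x∼y (ε ℚ.* ½) {{half-pos ε}} | M , k ← y∼z (ε ℚ.* ½) {{half-pos ε}}
  = N ℕ.⊔ M , λ m n ≤m ≤n →
    let N≤m = ℕ.m⊔n≤o⇒m≤o N M ≤m
        M≤m = ℕ.m⊔n≤o⇒n≤o N M ≤m
        M≤n = ℕ.m⊔n≤o⇒n≤o N M ≤n
    in ∣-∣-split {ε} (x m ℚ.- y m) (y m ℚ.- z n)
         (solve 3 (λ a b c → a :- c := (a :- b) :+ (b :- c)) ≡.refl (x m) (y m) (z n))
         (h m m N≤m N≤m) (k m n M≤m M≤n)
  where open +-*-Solver

∼-+ : ∀ {x x′ y y′} → x ∼ x′ → y ∼ y′ →
      (λ n → x n ℚ.+ y n) ∼ (λ n → x′ n ℚ.+ y′ n)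
∼-+ {x} {x′} {y} {y′} x∼x′ y∼y′ ε
  with N , h ← x∼x′ (ε ℚ.* ½) {{half-pos ε}} | M , k ← y∼y′ (ε ℚ.* ½) {{half-pos ε}}
  = N ℕ.⊔ M , λ m n ≤m ≤n →
    ∣-∣-split {ε} (x m ℚ.- x′ n) (y m ℚ.- y′ n)
      (solve 4 (λ a b c d → (a :+ c) :- (b :+ d) := (a :- b) :+ (c :- d)) ≡.refl
        (x m) (x′ n) (y m) (y′ n))
      (h m n (ℕ.m⊔n≤o⇒m≤o N M ≤m) (ℕ.m⊔n≤o⇒m≤o N M ≤n))
      (k m n (ℕ.m⊔n≤o⇒n≤o N M ≤m) (ℕ.m⊔n≤o⇒n≤o N M ≤n))
  where open +-*-Solver

∼-neg : ∀ {x y} → x ∼ y → (λ n → ℚ.- x n) ∼ (λ n → ℚ.- y n)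
∼-neg {x} {y} x∼y ε with N , h ← x∼y ε = N , λ m n N≤m N≤n →
  ≡.subst (ℚ._< ε) (neg-∣-∣ (x m) (y n)) (h m n N≤m N≤n)
  where
  open +-*-Solver
  neg-∣-∣ : ∀ p q → ℚ.∣ p ℚ.- q ∣ ≡ ℚ.∣ ℚ.- p ℚ.- ℚ.- q ∣
  neg-∣-∣ p q = ≡.trans (≡.sym (ℚ.∣-p∣≡∣p∣ (p ℚ.- q))) (cong ℚ.∣_∣
    (solve 2 (λ p q → :- (p :- q) := :- p :- (:- q)) ≡.refl p q))

eventually-bounded : ∀ {x} → x ∼ x →
  ∃[ B ] Positive B × ∃[ N ] (∀ n → N ℕ.≤ n → ℚ.∣ x n ∣ ℚ.< B)
eventually-bounded {x} x∼x with N , h ← x∼x 1ℚ =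
  ℚ.∣ x N ∣ ℚ.+ 1ℚ , ℚ.nonNeg+pos⇒pos ℚ.∣ x N ∣ {{ℚ.∣-∣-nonNeg (x N)}} 1ℚ ,
  N , λ n N≤n → begin-strict
    ℚ.∣ x n ∣                       ≡⟨ cong ℚ.∣_∣ (solve 2 (λ a b → a := b :+ (a :- b)) ≡.refl (x n) (x N)) ⟩
    ℚ.∣ x N ℚ.+ (x n ℚ.- x N) ∣     ≤⟨ ℚ.∣p+q∣≤∣p∣+∣q∣ (x N) (x n ℚ.- x N) ⟩
    ℚ.∣ x N ∣ ℚ.+ ℚ.∣ x n ℚ.- x N ∣ <⟨ ℚ.+-monoʳ-< ℚ.∣ x N ∣ (h n N N≤n ℕ.≤-refl) ⟩
    ℚ.∣ x N ∣ ℚ.+ 1ℚ                ∎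
  where
  open +-*-Solver
  open ℚ.≤-Reasoning

private
  -- A bound on p making p * q smaller than ε / 2 when ∣ q ∣ < B.
  δ : ∀ ε B → .{{Positive B}} → ℚ
  δ ε B = ε ℚ.* ½ ℚ.* ℚ.1/_ B {{ℚ.pos⇒nonZero B}}

  δ-pos : ∀ ε B → .{{_ : Positive B}} .{{_ : Positive ε}} → Positive (δ ε B)
  δ-pos ε B = ℚ.pos*pos⇒pos (ε ℚ.* ½) {{half-pos ε}}
    (ℚ.1/_ B {{ℚ.pos⇒nonZero B}}) {{ℚ.1/pos⇒pos B}}

  δ-cancel : ∀ ε B → .{{_ : Positive B}} → δ ε B ℚ.* B ≡ ε ℚ.* ½
  δ-cancel ε B = ≡.trans (ℚ.*-assoc (ε ℚ.* ½) (ℚ.1/_ B {{ℚ.pos⇒nonZero B}}) B)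
    (≡.trans (cong (ℚ._*_ (ε ℚ.* ½)) (ℚ.*-inverseˡ B {{ℚ.pos⇒nonZero B}})) (ℚ.*-identityʳ (ε ℚ.* ½)))

  ∣-∣-*-half : ∀ ε B .{{_ : Positive B}} p q →
               ℚ.∣ p ∣ ℚ.< δ ε B → ℚ.∣ q ∣ ℚ.< B → ℚ.∣ p ℚ.* q ∣ ℚ.< ε ℚ.* ½
  ∣-∣-*-half ε B p q p< q< =
    ≡.subst (ℚ.∣ p ℚ.* q ∣ ℚ.<_) (δ-cancel ε B) (∣-∣-* (δ ε B) B p q p< q<)

  difference-* : ∀ a b c d → a ℚ.* c ℚ.- b ℚ.* d ≡ (a ℚ.- b) ℚ.* c ℚ.+ (c ℚ.- d) ℚ.* b
  difference-* = solve 4 (λ a b c d → a :* c :- b :* d := (a :- b) :* c :+ (c :- d) :* b) ≡.refl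
    where open +-*-Solver

∼-* : ∀ {x x′ y y′} → x′ ∼ x′ → y ∼ y → x ∼ x′ → y ∼ y′ →
      (λ n → x n ℚ.* y n) ∼ (λ n → x′ n ℚ.* y′ n)
∼-* {x} {x′} {y} {y′} cx′ cy x∼x′ y∼y′ ε =
  let B , B>0 , K , b = eventually-bounded {y} cy
      C , C>0 , L , c = eventually-bounded {x′} cx′
      N , h = x∼x′ (δ ε B {{B>0}}) {{δ-pos ε B {{B>0}}}}
      M , k = y∼y′ (δ ε C {{C>0}}) {{δ-pos ε C {{C>0}}}}
  in (N ℕ.⊔ M) ℕ.⊔ (K ℕ.⊔ L) , λ m n ≤m ≤n →
     let ≤m₁ = ℕ.m⊔n≤o⇒m≤o (N ℕ.⊔ M) (K ℕ.⊔ L) ≤m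
         ≤m₂ = ℕ.m⊔n≤o⇒n≤o (N ℕ.⊔ M) (K ℕ.⊔ L) ≤m
         ≤n₁ = ℕ.m⊔n≤o⇒m≤o (N ℕ.⊔ M) (K ℕ.⊔ L) ≤n
         ≤n₂ = ℕ.m⊔n≤o⇒n≤o (N ℕ.⊔ M) (K ℕ.⊔ L) ≤n
     in ∣-∣-split {ε} ((x m ℚ.- x′ n) ℚ.* y m) ((y m ℚ.- y′ n) ℚ.* x′ n)
          (difference-* (x m) (x′ n) (y m) (y′ n))
          (∣-∣-*-half ε B {{B>0}} (x m ℚ.- x′ n) (y m)
            (h m n (ℕ.m⊔n≤o⇒m≤o N M ≤m₁) (ℕ.m⊔n≤o⇒m≤o N M ≤n₁)) (b m (ℕ.m⊔n≤o⇒m≤o K L ≤m₂)))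
          (∣-∣-*-half ε C {{C>0}} (y m ℚ.- y′ n) (x′ n)
            (k m n (ℕ.m⊔n≤o⇒n≤o N M ≤m₁) (ℕ.m⊔n≤o⇒n≤o N M ≤n₁)) (c n (ℕ.m⊔n≤o⇒n≤o K L ≤n₂)))

infixl 6 _+ᴿ_
infixl 7 _*ᴿ_
infix  8 -ᴿ_

_+ᴿ_ _*ᴿ_ : ℝ → ℝ → ℝ
real x cx +ᴿ real y cy = real (λ n → x n ℚ.+ y n) (∼-+ {x} {x} {y} {y} cx cy)
real x cx *ᴿ real y cy = real (λ n → x n ℚ.* y n) (∼-* {x} {x} {y} {y} cx cy cx cy)

-ᴿ_ : ℝ → ℝ
-ᴿ real x cx = real (λ n → ℚ.- x n) (∼-neg {x} {x} cx)

fromℚ : ℚ → ℝ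
fromℚ q = real (λ _ → q) λ ε → 0 , λ _ _ _ _ →
  ≡.subst (ℚ._< ε) (≡.sym (cong ℚ.∣_∣ (ℚ.+-inverseʳ q))) (ℚ.positive⁻¹ ε)

≗⇒≈ᴿ : ∀ x y → (∀ n → seq x n ≡ seq y n) → x ≈ᴿ y
≗⇒≈ᴿ x y x≗y ε with N , h ← cauchy x ε = N , λ m n N≤m N≤n →
  ≡.subst (λ q → ℚ.∣ seq x m ℚ.- q ∣ ℚ.< ε) (x≗y n) (h m n N≤m N≤n)

ℝ-commutativeRing : CommutativeRing 0ℓ 0ℓ
ℝ-commutativeRing = record
  { Carrier = ℝ
  ; _≈_ = _≈ᴿ_
  ; _+_ = _+ᴿ_
  ; _*_ = _*ᴿ_
  ; -_  = -ᴿ_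
  ; 0#  = fromℚ 0ℚ
  ; 1#  = fromℚ 1ℚ
  ; isCommutativeRing = record
    { isRing = record
      { +-isAbelianGroup = record
        { isGroup = record
          { isMonoid = record
            { isSemigroup = record
              { isMagma = record
                { isEquivalence = record
                  { refl  = λ {x} → cauchy x
                  ; sym   = λ {x} {y} → ∼-sym {seq x} {seq y}
                  ; trans = λ {x} {y} {z} → ∼-trans {seq x} {seq y} {seq z}
                  }
                ; ∙-cong = λ {x} {x′} {y} {y′} → ∼-+ {seq x} {seq x′} {seq y} {seq y′}
                }
              ; assoc = λ x y z → ≗⇒≈ᴿ ((x +ᴿ y) +ᴿ z) (x +ᴿ (y +ᴿ z))
                  λ n → ℚ.+-assoc (seq x n) (seq y n) (seq z n)
              }
            ; identity = (λ x → ≗⇒≈ᴿ (fromℚ 0ℚ +ᴿ x) x λ n → ℚ.+-identityˡ (seq x n))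
                       , (λ x → ≗⇒≈ᴿ (x +ᴿ fromℚ 0ℚ) x λ n → ℚ.+-identityʳ (seq x n))
            }
          ; inverse = (λ x → ≗⇒≈ᴿ (-ᴿ x +ᴿ x) (fromℚ 0ℚ) λ n → ℚ.+-inverseˡ (seq x n))
                    , (λ x → ≗⇒≈ᴿ (x +ᴿ -ᴿ x) (fromℚ 0ℚ) λ n → ℚ.+-inverseʳ (seq x n))
          ; ⁻¹-cong = λ {x} {y} → ∼-neg {seq x} {seq y}
          }
        ; comm = λ x y → ≗⇒≈ᴿ (x +ᴿ y) (y +ᴿ x) λ n → ℚ.+-comm (seq x n) (seq y n)
        }
      ; *-cong = λ {x} {x′} {y} {y′} →
          ∼-* {seq x} {seq x′} {seq y} {seq y′} (cauchy x′) (cauchy y)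
      ; *-assoc = λ x y z → ≗⇒≈ᴿ ((x *ᴿ y) *ᴿ z) (x *ᴿ (y *ᴿ z))
          λ n → ℚ.*-assoc (seq x n) (seq y n) (seq z n)
      ; *-identity = (λ x → ≗⇒≈ᴿ (fromℚ 1ℚ *ᴿ x) x λ n → ℚ.*-identityˡ (seq x n))
                   , (λ x → ≗⇒≈ᴿ (x *ᴿ fromℚ 1ℚ) x λ n → ℚ.*-identityʳ (seq x n))
      ; distrib = (λ x y z → ≗⇒≈ᴿ (x *ᴿ (y +ᴿ z)) (x *ᴿ y +ᴿ x *ᴿ z)
                     λ n → ℚ.*-distribˡ-+ (seq x n) (seq y n) (seq z n))
                , (λ x y z → ≗⇒≈ᴿ ((y +ᴿ z) *ᴿ x) (y *ᴿ x +ᴿ z *ᴿ x)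
                     λ n → ℚ.*-distribʳ-+ (seq x n) (seq y n) (seq z n))
      }
    ; *-comm = λ x y → ≗⇒≈ᴿ (x *ᴿ y) (y *ᴿ x) λ n → ℚ.*-comm (seq x n) (seq y n)
    }
  }

-- The pair (a , b) stands for a + b i, where i² = -1.

private
  module ℝᵣ = CommutativeRing ℝ-commutativeRing
  module ℝ² = AbelianGroup (DirectProduct.abelianGroup ℝᵣ.+-abelianGroup ℝᵣ.+-abelianGroup)

infixl 7 _*ᶜ_

_*ᶜ_ : ℝ × ℝ → ℝ × ℝ → ℝ × ℝ
(a , b) *ᶜ (c , d) = (a ℝᵣ.* c ℝᵣ.- b ℝᵣ.* d) , (a ℝᵣ.* d ℝᵣ.+ b ℝᵣ.* c)

1ᶜ : ℝ × ℝ
1ᶜ = ℝᵣ.1# , ℝᵣ.0#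

private
  module Identities where
    open Data.Rational.Base using (_+_; _*_; _-_)
    open +-*-Solver

    assoc-re : ∀ a b c d e f →
      (a * c - b * d) * e - (a * d + b * c) * f ≡ a * (c * e - d * f) - b * (c * f + d * e)
    assoc-re = solve 6 (λ a b c d e f →
      (a :* c :- b :* d) :* e :- (a :* d :+ b :* c) :* f :=
      a :* (c :* e :- d :* f) :- b :* (c :* f :+ d :* e)) ≡.refl

    assoc-im : ∀ a b c d e f →
      (a * c - b * d) * f + (a * d + b * c) * e ≡ a * (c * f + d * e) + b * (c * e - d * f)
    assoc-im = solve 6 (λ a b c d e f →
      (a :* c :- b :* d) :* f :+ (a :* d :+ b :* c) :* e :=
      a :* (c :* f :+ d :* e) :+ b :* (c :* e :- d :* f)) ≡.refl

    identity-re : ∀ a b → 1ℚ * a - 0ℚ * b ≡ a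
    identity-re = solve 2 (λ a b → con 1ℚ :* a :- con 0ℚ :* b := a) ≡.refl

    identity-im : ∀ a b → 1ℚ * b + 0ℚ * a ≡ b
    identity-im = solve 2 (λ a b → con 1ℚ :* b :+ con 0ℚ :* a := b) ≡.refl

    comm-re : ∀ a b c d → a * c - b * d ≡ c * a - d * b
    comm-re = solve 4 (λ a b c d → a :* c :- b :* d := c :* a :- d :* b) ≡.refl

    comm-im : ∀ a b c d → a * d + b * c ≡ c * b + d * a
    comm-im = solve 4 (λ a b c d → a :* d :+ b :* c := c :* b :+ d :* a) ≡.refl

    distrib-re : ∀ a b c d e f →
      a * (c + e) - b * (d + f) ≡ (a * c - b * d) + (a * e - b * f)
    distrib-re = solve 6 (λ a b c d e f →
      a :* (c :+ e) :- b :* (d :+ f) := (a :* c :- b :* d) :+ (a :* e :- b :* f)) ≡.refl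

    distrib-im : ∀ a b c d e f →
      a * (d + f) + b * (c + e) ≡ (a * d + b * c) + (a * f + b * e)
    distrib-im = solve 6 (λ a b c d e f →
      a :* (d :+ f) :+ b :* (c :+ e) := (a :* d :+ b :* c) :+ (a :* f :+ b :* e)) ≡.refl

  module I = Identities

  ≗⇒≈ᶜ : ∀ x y → (∀ n → seq (proj₁ x) n ≡ seq (proj₁ y) n) →
         (∀ n → seq (proj₂ x) n ≡ seq (proj₂ y) n) → x ℝ².≈ y
  ≗⇒≈ᶜ (a , b) (c , d) p q = ≗⇒≈ᴿ a c p , ≗⇒≈ᴿ b d q

  *ᶜ-assoc : ∀ x y z → (x *ᶜ y) *ᶜ z ℝ².≈ x *ᶜ (y *ᶜ z)
  *ᶜ-assoc x@(a , b) y@(c , d) z@(e , f) = ≗⇒≈ᶜ ((x *ᶜ y) *ᶜ z) (x *ᶜ (y *ᶜ z))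
    (λ n → I.assoc-re (seq a n) (seq b n) (seq c n) (seq d n) (seq e n) (seq f n))
    (λ n → I.assoc-im (seq a n) (seq b n) (seq c n) (seq d n) (seq e n) (seq f n))

  *ᶜ-comm : ∀ x y → x *ᶜ y ℝ².≈ y *ᶜ x
  *ᶜ-comm x@(a , b) y@(c , d) = ≗⇒≈ᶜ (x *ᶜ y) (y *ᶜ x)
    (λ n → I.comm-re (seq a n) (seq b n) (seq c n) (seq d n))
    (λ n → I.comm-im (seq a n) (seq b n) (seq c n) (seq d n))

  *ᶜ-identityˡ : ∀ x → 1ᶜ *ᶜ x ℝ².≈ x
  *ᶜ-identityˡ x@(a , b) = ≗⇒≈ᶜ (1ᶜ *ᶜ x) x
    (λ n → I.identity-re (seq a n) (seq b n))
    (λ n → I.identity-im (seq a n) (seq b n))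

  *ᶜ-distribˡ : ∀ x y z → x *ᶜ (y ℝ².∙ z) ℝ².≈ (x *ᶜ y) ℝ².∙ (x *ᶜ z)
  *ᶜ-distribˡ x@(a , b) y@(c , d) z@(e , f) = ≗⇒≈ᶜ (x *ᶜ (y ℝ².∙ z)) ((x *ᶜ y) ℝ².∙ (x *ᶜ z))
    (λ n → I.distrib-re (seq a n) (seq b n) (seq c n) (seq d n) (seq e n) (seq f n))
    (λ n → I.distrib-im (seq a n) (seq b n) (seq c n) (seq d n) (seq e n) (seq f n))

  *ᶜ-cong : ∀ {x x′ y y′} → x ℝ².≈ x′ → y ℝ².≈ y′ → x *ᶜ y ℝ².≈ x′ *ᶜ y′
  *ᶜ-cong {a , b} {a′ , b′} {c , d} {c′ , d′} (p , q) (r , s) =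
    ℝᵣ.+-cong {a ℝᵣ.* c} {a′ ℝᵣ.* c′} {ℝᵣ.- (b ℝᵣ.* d)} {ℝᵣ.- (b′ ℝᵣ.* d′)}
      (ℝᵣ.*-cong {a} {a′} {c} {c′} p r)
      (ℝᵣ.-‿cong {b ℝᵣ.* d} {b′ ℝᵣ.* d′} (ℝᵣ.*-cong {b} {b′} {d} {d′} q s)) ,
    ℝᵣ.+-cong {a ℝᵣ.* d} {a′ ℝᵣ.* d′} {b ℝᵣ.* c} {b′ ℝᵣ.* c′}
      (ℝᵣ.*-cong {a} {a′} {d} {d′} p s) (ℝᵣ.*-cong {b} {b′} {c} {c′} q r)

ℂ-commutativeRing : CommutativeRing 0ℓ 0ℓ
ℂ-commutativeRing = record
  { Carrier = ℝ × ℝ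
  ; _*_ = _*ᶜ_
  ; 1#  = 1ᶜ
  ; isCommutativeRing = record
    { isRing = record
      { +-isAbelianGroup = ℝ².isAbelianGroup
      ; *-cong = λ {x} {x′} {y} {y′} → *ᶜ-cong {x} {x′} {y} {y′}
      ; *-assoc = *ᶜ-assoc
      ; *-identity = *ᶜ-identityˡ , λ x →
          ℝ².trans {x *ᶜ 1ᶜ} {1ᶜ *ᶜ x} {x} (*ᶜ-comm x 1ᶜ) (*ᶜ-identityˡ x)
      ; distrib = *ᶜ-distribˡ , λ x y z →
          ℝ².trans {(y ℝ².∙ z) *ᶜ x} {x *ᶜ (y ℝ².∙ z)} {(y *ᶜ x) ℝ².∙ (z *ᶜ x)}
            (*ᶜ-comm (y ℝ².∙ z) x)
            (ℝ².trans {x *ᶜ (y ℝ².∙ z)} {(x *ᶜ y) ℝ².∙ (x *ᶜ z)} {(y *ᶜ x) ℝ².∙ (z *ᶜ x)}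
              (*ᶜ-distribˡ x y z)
              (ℝ².∙-cong {x *ᶜ y} {y *ᶜ x} {x *ᶜ z} {z *ᶜ x} (*ᶜ-comm x y) (*ᶜ-comm x z)))
      }
    ; *-comm = *ᶜ-comm
    }
  }

open CommutativeRing ℂ-commutativeRing public
  using (_≈_; _+_; _*_; _-_; -_; 0#; 1#)
  renaming (Carrier to ℂ)

private module ℂ = CommutativeRing ℂ-commutativeRing

open Algebra.Properties.Semiring.Exp ℂ.semiring public using (_^_)
open Algebra.Properties.CommutativeMonoid.Sum ℂ.+-commutativeMonoid public
  using () renaming (sum to ∑)
open Algebra.Properties.CommutativeMonoid.Sum ℂ.*-commutativeMonoid public
  using () renaming (sum to ∏)

fromℕ : ℕ → ℂ
fromℕ n = n · 1#
  where open Algebra.Properties.Monoid.Mult ℂ.+-monoid using () renaming (_×_ to _·_)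

-- Constructively, a nonzero complex number is one that has an inverse
-- (equivalently, that is apart from 0), and division needs that inverse.
-- Inverses are unique, so quotients and negative powers do not depend on
-- the IsUnit argument up to _≈_.

IsUnit : ℂ → Set
IsUnit = Algebra.Definitions.Invertible _≈_ 1# _*_

infixl 7 _/_[_]
infixr 8 _^ℤ_[_]

_/_[_] : (x y : ℂ) → IsUnit y → ℂ
x / y [ (y⁻¹ , _) ] = x * y⁻¹

_^ℤ_[_] : (x : ℂ) → ℤ → IsUnit x → ℂ
x ^ℤ + n      [ _ ]         = x ^ n
x ^ℤ -[1+ n ] [ (x⁻¹ , _) ] = x⁻¹ ^ suc n

open Algebra.Properties.CommutativeMonoid.Sum ℕ.+-0-commutativeMonoid
  using () renaming (sum to ∑ℕ; sum-cong-≗ to ∑ℕ-cong)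

-- fibBack k m j is the term of index m + 1 - j.

fibBack : (k m j : ℕ) → ℕ
fibBack k zero    zero    = 1
fibBack k zero    (suc j) = 0
fibBack k (suc m) zero    = ∑ℕ {k} λ j → fibBack k m (toℕ j)
fibBack k (suc m) (suc j) = fibBack k m j

-- The value 0 at indices below 2 - k is irrelevant: those indices lie
-- outside the domain of the sequence.

F : (k : ℕ) → ℤ → ℕ
F k (+ suc m) = fibBack k m 0
F k (+ zero)  = 0
F k -[1+ _ ]  = 0

private
  fibBack-F : ∀ k m j → fibBack k m j ≡ F k (suc m ℤ.⊖ j)
  fibBack-F k m       zero          = ≡.refl
  fibBack-F k zero    (suc zero)    = ≡.refl
  fibBack-F k zero    (suc (suc j)) = ≡.sym (cong (F k) (ℤ.[1+m]⊖[1+n]≡m⊖n 0 (suc j)))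
  fibBack-F k (suc m) (suc j)       =
    ≡.trans (fibBack-F k m j) (≡.sym (cong (F k) (ℤ.[1+m]⊖[1+n]≡m⊖n (suc m) j)))

F-nonPositive : ∀ k n → n ℤ.≤ + 0 → F k n ≡ 0
F-nonPositive k (+ zero)  _           = ≡.refl
F-nonPositive k (+ suc _) (ℤ.+≤+ ())
F-nonPositive k -[1+ _ ]  _           = ≡.refl

F-one : ∀ k → F k (+ 1) ≡ 1
F-one k = ≡.refl

F-recurrence : ∀ k n → + 2 ℤ.≤ n →
               F k n ≡ ∑ℕ {k} λ j → F k (n ℤ.- + suc (toℕ j))
F-recurrence k (+ suc zero)    (ℤ.+≤+ (ℕ.s≤s ()))
F-recurrence k (+ suc (suc m)) _ = ∑ℕ-cong {k} λ j →
  ≡.trans (fibBack-F k m (toℕ j)) (≡.sym (cong (F k)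
    (≡.trans (ℤ.m-n≡m⊖n (suc (suc m)) (suc (toℕ j)))
             (ℤ.[1+m]⊖[1+n]≡m⊖n (suc m) (toℕ j)))))

charPoly : ℕ → ℂ → ℂ
charPoly k x = x ^ k - ∑ {k} λ j → x ^ toℕ j

-- α lists the k roots of the monic polynomial charPoly k of degree k, each
-- as often as its multiplicity.  Distinctness is not assumed.

AreRoots : (k : ℕ) → (Fin k → ℂ) → Set
AreRoots k α = ∀ x → charPoly k x ≈ ∏ λ i → x - α i

denominator : ℕ → ℂ → ℂ
denominator k a = fromℕ 2 + fromℕ (k ℕ.+ 1) * (a - fromℕ 2)

{-# OPTIONS --safe #-}
module Submission where

-- Write f = charPoly k.  The interpolation formula for x ^ j at the roots,
-- evaluated at 0, gives Σ αᵢ ^ (j - 1) / f′(αᵢ) = 0 ^ j for 0 ≤ j < k, where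
-- f′(αᵢ) = ∏_{j ≠ i} (αᵢ - αⱼ) is the cofactor below.  Differentiating
-- (x - 1) f(x) = x ^ (k + 1) - 2 x ^ k + 1 at αᵢ identifies (αᵢ - 1) / dᵢ with
-- αᵢ ^ (k - 1) / f′(αᵢ), where dᵢ = denominator k αᵢ.  So the right-hand side has
-- the initial values of the sequence, and it satisfies the recurrence because
-- each αᵢ is a root.
--
-- All units are obtained by factoring: ∏ dᵢ is, up to sign, (k + 1) ^ k times the
-- value of f at 2k / (k + 1), a rational number that is nonzero because k does not
-- divide (k + 1) ^ (k + 1); then the formula for f′(αᵢ) makes αᵢ - αⱼ a unit too.
-- The argument takes place in any commutative ring where positive integers are
-- units.

open import Algebra.Bundles using (CommutativeRing)
import Algebra.Definitions
import Algebra.Properties.AbelianGroup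
import Algebra.Properties.CommutativeMonoid
import Algebra.Properties.CommutativeMonoid.Sum
import Algebra.Properties.CommutativeSemigroup
import Algebra.Properties.CommutativeSemiring.Exp
import Algebra.Properties.Group
import Algebra.Properties.Ring
import Algebra.Properties.Semiring.Mult
import Algebra.Properties.Semiring.Mult.TCOptimised
import Algebra.Properties.Semiring.Sum
import Algebra.Solver.Ring
open import Algebra.Solver.Ring.AlmostCommutativeRing using (fromCommutativeRing; _-Raw-AlmostCommutative⟶_)
open import Data.Fin.Base using (Fin; zero; suc; toℕ; punchIn; punchOut)
import Data.Fin.Properties as Fin
open import Data.Integer.Base as ℤ using (ℤ; +_; -[1+_])
import Data.Integer.Properties as ℤ
open import Data.Maybe.Base using (Maybe; just; nothing)
open import Data.Nat.Base as ℕ using (ℕ; zero; suc)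
open import Data.Nat.Divisibility using (_∣_)
import Data.Nat.Divisibility as ∣
import Data.Nat.Properties as ℕ
open import Data.Product.Base using (Σ-syntax; _×_; _,_; proj₁; proj₂)
open import Data.Rational.Base as ℚ using (ℚ; 0ℚ; 1ℚ)
import Data.Rational.Properties as ℚ
open import Data.Vec.Functional using (removeAt)
open import Function.Base using (_∘_)
open import Level using (_⊔_)
open import Relation.Binary.PropositionalEquality.Core as ≡ using (_≡_; _≢_)
open import Relation.Nullary.Decidable.Core using (yes; no)
open import Relation.Nullary.Negation.Core using (contradiction)

open import Defs using (F; fibBack)

-- A ring solver with integer coefficients over any commutative ring.

module IntegerCoefficients {c ℓ} (R : CommutativeRing c ℓ) where
  open CommutativeRing R hiding (zero)
  open Algebra.Properties.AbelianGroup +-abelianGroup using (⁻¹-∙-comm)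
  open Algebra.Properties.CommutativeSemigroup +-commutativeSemigroup using (interchange)
  open Algebra.Properties.Group +-group using (ε⁻¹≈ε; ⁻¹-involutive)
  open Algebra.Properties.Ring ring using (-‿distribˡ-*; -‿distribʳ-*)
  open Algebra.Properties.Semiring.Mult.TCOptimised semiring using (×-homo-+; ×1-homo-*; 1+×)
    renaming (_×_ to _·_)
  open import Relation.Binary.Reasoning.Setoid setoid

  -- The type-checking-optimised multiple makes `con (+ 1)` evaluate to `1#` and `con (+ 2)` to
  -- `1# + 1#`, so solved equations match the terms written by hand.
  fromℤ : ℤ → Carrier
  fromℤ (+ n)    = n · 1#
  fromℤ -[1+ n ] = - (suc n · 1#)

  fromℤ-cong : ∀ {i j} → i ≡ j → fromℤ i ≈ fromℤ j
  fromℤ-cong ≡.refl = refl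

  fromℤ-⊖ : ∀ m n → fromℤ (m ℤ.⊖ n) ≈ m · 1# - n · 1#
  fromℤ-⊖ m       zero    = sym (trans (+-congˡ ε⁻¹≈ε) (+-identityʳ _))
  fromℤ-⊖ zero    (suc n) = sym (+-identityˡ _)
  fromℤ-⊖ (suc m) (suc n) = begin
    fromℤ (suc m ℤ.⊖ suc n)             ≈⟨ fromℤ-cong (ℤ.[1+m]⊖[1+n]≡m⊖n m n) ⟩
    fromℤ (m ℤ.⊖ n)                     ≈⟨ fromℤ-⊖ m n ⟩
    m · 1# - n · 1#                     ≈⟨ +-identityˡ _ ⟨
    0# + (m · 1# - n · 1#)              ≈⟨ +-congʳ (-‿inverseʳ 1#) ⟨
    (1# - 1#) + (m · 1# - n · 1#)       ≈⟨ interchange 1# (- 1#) (m · 1#) (- (n · 1#)) ⟩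
    (1# + m · 1#) + (- 1# - n · 1#)     ≈⟨ +-congˡ (⁻¹-∙-comm 1# (n · 1#)) ⟩
    (1# + m · 1#) - (1# + n · 1#)       ≈⟨ +-cong (1+× m 1#) (-‿cong (1+× n 1#)) ⟨
    suc m · 1# - suc n · 1#             ∎

  fromℤ-neg : ∀ i → fromℤ (ℤ.- i) ≈ - fromℤ i
  fromℤ-neg (+ zero)  = sym ε⁻¹≈ε
  fromℤ-neg (+ suc n) = refl
  fromℤ-neg -[1+ n ]  = sym (⁻¹-involutive _)

  fromℤ-+ : ∀ i j → fromℤ (i ℤ.+ j) ≈ fromℤ i + fromℤ j
  fromℤ-+ (+ m)    (+ n)    = ×-homo-+ 1# m n
  fromℤ-+ (+ m)    -[1+ n ] = fromℤ-⊖ m (suc n)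
  fromℤ-+ -[1+ m ] (+ n)    = trans (fromℤ-⊖ n (suc m)) (+-comm _ _)
  fromℤ-+ -[1+ m ] -[1+ n ] = begin
    - (suc (suc (m ℕ.+ n)) · 1#)     ≡⟨ ≡.cong (λ l → - (suc l · 1#)) (ℕ.+-suc m n) ⟨
    - ((suc m ℕ.+ suc n) · 1#)       ≈⟨ -‿cong (×-homo-+ 1# (suc m) (suc n)) ⟩
    - (suc m · 1# + suc n · 1#)      ≈⟨ ⁻¹-∙-comm _ _ ⟨
    - (suc m · 1#) - suc n · 1#      ∎

  fromℤ-pos-* : ∀ m j → fromℤ (+ m ℤ.* j) ≈ fromℤ (+ m) * fromℤ j
  fromℤ-pos-* m (+ n)    = trans (fromℤ-cong (≡.sym (ℤ.pos-* m n))) (×1-homo-* m n)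
  fromℤ-pos-* m -[1+ n ] = begin
    fromℤ (+ m ℤ.* -[1+ n ])              ≈⟨ fromℤ-cong (ℤ.neg-distribʳ-* (+ m) (+ suc n)) ⟨
    fromℤ (ℤ.- (+ m ℤ.* + suc n))         ≈⟨ fromℤ-neg (+ m ℤ.* + suc n) ⟩
    - fromℤ (+ m ℤ.* + suc n)             ≈⟨ -‿cong (fromℤ-pos-* m (+ suc n)) ⟩
    - (m · 1# * (suc n · 1#))             ≈⟨ -‿distribʳ-* _ _ ⟩
    m · 1# * - (suc n · 1#)               ∎

  fromℤ-* : ∀ i j → fromℤ (i ℤ.* j) ≈ fromℤ i * fromℤ j
  fromℤ-* (+ m)    j = fromℤ-pos-* m j
  fromℤ-* -[1+ m ] j = begin
    fromℤ (-[1+ m ] ℤ.* j)                ≈⟨ fromℤ-cong (ℤ.neg-distribˡ-* (+ suc m) j) ⟨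
    fromℤ (ℤ.- (+ suc m ℤ.* j))           ≈⟨ fromℤ-neg (+ suc m ℤ.* j) ⟩
    - fromℤ (+ suc m ℤ.* j)               ≈⟨ -‿cong (fromℤ-pos-* (suc m) j) ⟩
    - (suc m · 1# * fromℤ j)              ≈⟨ -‿distribˡ-* _ _ ⟩
    - (suc m · 1#) * fromℤ j              ∎

  homomorphism : ℤ.+-*-rawRing -Raw-AlmostCommutative⟶ fromCommutativeRing R
  homomorphism = record
    { ⟦_⟧    = fromℤ
    ; +-homo = fromℤ-+
    ; *-homo = fromℤ-*
    ; -‿homo = fromℤ-neg
    ; 0-homo = refl
    ; 1-homo = refl
    }

  weaklyDecidable : ∀ i j → Maybe (fromℤ i ≈ fromℤ j)
  weaklyDecidable i j with i ℤ.≟ j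
  ... | yes i≡j = just (fromℤ-cong i≡j)
  ... | no  _   = nothing

  open Algebra.Solver.Ring ℤ.+-*-rawRing (fromCommutativeRing R) homomorphism weaklyDecidable public
    using (solve; _:=_; _:+_; _:*_; _:-_; :-_; con)

-- Units of a commutative ring.

module Units {c ℓ} (R : CommutativeRing c ℓ) where
  open CommutativeRing R hiding (zero)
  open IntegerCoefficients R
  open Algebra.Properties.CommutativeMonoid *-commutativeMonoid using (invertibleʳ⇒invertible)
  open import Relation.Binary.Reasoning.Setoid setoid
  open Algebra.Properties.CommutativeSemiring.Exp commutativeSemiring using (_^_)
  open Algebra.Properties.CommutativeMonoid.Sum *-commutativeMonoid
    using () renaming (sum to ∏; sum-remove to ∏-remove)

  Unit : Carrier → Set (c ⊔ ℓ)
  Unit = Algebra.Definitions.Invertible _≈_ 1# _*_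

  private variable
    x y : Carrier

  unit : ∀ y → x * y ≈ 1# → Unit x
  unit y xy≈1 = invertibleʳ⇒invertible (y , xy≈1)

  unit-cong : x ≈ y → Unit x → Unit y
  unit-cong x≈y (z , _ , xz≈1) = unit z (trans (*-congʳ (sym x≈y)) xz≈1)

  unit-1 : Unit 1#
  unit-1 = unit 1# (*-identityˡ 1#)

  unit-* : Unit x → Unit y → Unit (x * y)
  unit-* {x} {y} (u , _ , xu≈1) (v , _ , yv≈1) = unit (u * v) (begin
    x * y * (u * v)    ≈⟨ solve 4 (λ x y u v → x :* y :* (u :* v) := x :* u :* (y :* v)) refl x y u v ⟩
    x * u * (y * v)    ≈⟨ *-cong xu≈1 yv≈1 ⟩
    1# * 1#            ≈⟨ *-identityˡ 1# ⟩
    1#                 ∎)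

  unit-^ : Unit x → ∀ n → Unit (x ^ n)
  unit-^ ux zero    = unit-1
  unit-^ ux (suc n) = unit-* ux (unit-^ ux n)

  -- The counterpart of `_^ℤ_[_]` over an arbitrary ring, with matching clauses.
  power : ∀ x → ℤ → Unit x → Carrier
  power x (+ n)    _ = x ^ n
  power x -[1+ n ] u = proj₁ u ^ suc n

  unit-neg : Unit x → Unit (- x)
  unit-neg {x} (u , _ , xu≈1) = unit (- u)
    (trans (solve 2 (λ x u → :- x :* :- u := x :* u) refl x u) xu≈1)

  unit-flip : Unit (x - y) → Unit (y - x)
  unit-flip {x} {y} = unit-cong (solve 2 (λ x y → :- (x :- y) := y :- x) refl x y) ∘ unit-neg

  unit-factorˡ : Unit (x * y) → Unit x
  unit-factorˡ {x} {y} (u , _ , xyu≈1) = unit (y * u) (trans (sym (*-assoc x y u)) xyu≈1)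

  unit-factorʳ : Unit (x * y) → Unit y
  unit-factorʳ {x} {y} u = unit-factorˡ (unit-cong (*-comm x y) u)

  unit-∏ : ∀ {n} (t : Fin n → Carrier) → Unit (∏ t) → ∀ i → Unit (t i)
  unit-∏ {suc n} t u i = unit-factorˡ (unit-cong (∏-remove {i = i} t) u)

  cancel : ∀ {z} → Unit x → x * y ≈ x * z → y ≈ z
  cancel {x} {y} {z} (u , ux≈1 , _) xy≈xz = begin
    y            ≈⟨ *-identityˡ y ⟨
    1# * y       ≈⟨ *-congʳ ux≈1 ⟨
    u * x * y    ≈⟨ *-assoc u x y ⟩
    u * (x * y)  ≈⟨ *-congˡ xy≈xz ⟩
    u * (x * z)  ≈⟨ *-assoc u x z ⟨
    u * x * z    ≈⟨ *-congʳ ux≈1 ⟩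
    1# * z       ≈⟨ *-identityˡ z ⟩
    z            ∎

  cancel-0 : Unit x → x * y ≈ 0# → y ≈ 0#
  cancel-0 {x} ux xy≈0 = cancel ux (trans xy≈0 (sym (zeroʳ x)))

  -- This transfers a formula proved with convenient inverses to any other choice of them.
  inverse-unique : x ≈ y → (u : Unit y) (v : Unit x) → proj₁ u ≈ proj₁ v
  inverse-unique x≈y u@(_ , _ , yu≈1) (_ , _ , xv≈1) =
    cancel u (trans yu≈1 (trans (sym xv≈1) (*-congʳ x≈y)))

  binet-term : ∀ n → Unit x → Carrier → Carrier
  binet-term {x} n x≠0 d⁻¹ = (x - 1#) * d⁻¹ * power x (n ℤ.- + 1) x≠0

  -- Every intermediate result is a variable over an abstract ring, so that the summand over `ℂ` can
  -- be assembled one operation at a time.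
  binet-term-≡ : ∀ n (x≠0 : Unit x) d⁻¹ {one u q p t} →
    one ≡ 1# → u ≡ x - one → q ≡ u * d⁻¹ → p ≡ power x (n ℤ.- + 1) x≠0 → t ≡ q * p →
    t ≡ binet-term n x≠0 d⁻¹
  binet-term-≡ n x≠0 d⁻¹ ≡.refl ≡.refl ≡.refl ≡.refl ≡.refl = ≡.refl

-- Natural numbers in a ring.

module Naturals {c ℓ} (R : CommutativeRing c ℓ) where
  open CommutativeRing R hiding (zero)
  open Algebra.Properties.CommutativeSemiring.Exp commutativeSemiring using (_^_)
  open Algebra.Properties.CommutativeMonoid.Sum +-commutativeMonoid using (sum)
  open Algebra.Properties.CommutativeMonoid.Sum ℕ.+-0-commutativeMonoid
    using () renaming (sum to ∑ℕ)
  open Algebra.Properties.Semiring.Mult semiring using (×-homo-+; ×1-homo-*)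
    renaming (_×_ to _·_)

  -- This is the unoptimised multiple, in agreement with `fromℕ` over `ℂ`; `natural-1` and
  -- `natural-2` link it to the solver's constants.
  natural : ℕ → Carrier
  natural n = n · 1#

  natural-+ : ∀ m n → natural (m ℕ.+ n) ≈ natural m + natural n
  natural-+ = ×-homo-+ 1#

  natural-* : ∀ m n → natural (m ℕ.* n) ≈ natural m * natural n
  natural-* = ×1-homo-*

  natural-1 : natural 1 ≈ 1#
  natural-1 = +-identityʳ 1#

  natural-2 : natural 2 ≈ 1# + 1#
  natural-2 = +-congˡ natural-1

  natural-^ : ∀ m n → natural (m ℕ.^ n) ≈ natural m ^ n
  natural-^ m zero    = natural-1
  natural-^ m (suc n) = trans (natural-* m (m ℕ.^ n)) (*-congˡ (natural-^ m n))

  natural-∑ : ∀ {n} (t : Fin n → ℕ) → natural (∑ℕ t) ≈ sum (natural ∘ t)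
  natural-∑ {zero}  t = refl
  natural-∑ {suc n} t = trans (natural-+ (t zero) _) (+-congˡ (natural-∑ (t ∘ suc)))

-- Polynomial functions of bounded degree and their zeros.

module PolynomialFunctions {c ℓ} (R : CommutativeRing c ℓ) where
  open CommutativeRing R hiding (zero)
  open IntegerCoefficients R
  open Units R
  open import Relation.Binary.Reasoning.Setoid setoid
  open Algebra.Properties.CommutativeSemiring.Exp commutativeSemiring using (_^_)
  open Algebra.Properties.Semiring.Sum semiring using (sum)
  open Algebra.Properties.CommutativeMonoid.Sum *-commutativeMonoid
    using () renaming (sum to ∏)

  -- Polynomial functions of degree less than n, described by iterated divided
  -- differences instead of coefficients.
  Degree< : ℕ → (Carrier → Carrier) → Set (c ⊔ ℓ)
  Degree< zero    r = ∀ x → r x ≈ 0#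
  Degree< (suc n) r = ∀ a → Σ[ q ∈ (Carrier → Carrier) ] Degree< n q ×
                      (∀ x → r x ≈ r a + (x - a) * q x)

  degree-0 : ∀ n → Degree< n λ _ → 0#
  degree-0 zero    _ = refl
  degree-0 (suc n) a = _ , degree-0 n , λ x →
    solve 2 (λ x a → con (+ 0) := con (+ 0) :+ (x :- a) :* con (+ 0)) refl x a

  degree-constant : ∀ n b → Degree< (suc n) λ _ → b
  degree-constant n b a = _ , degree-0 n , λ x →
    solve 3 (λ b x a → b := b :+ (x :- a) :* con (+ 0)) refl b x a

  degree-+ : ∀ n {r s} → Degree< n r → Degree< n s → Degree< n λ x → r x + s x
  degree-+ zero    dr ds x =
    trans (+-cong (dr x) (ds x)) (+-identityˡ 0#)
  degree-+ (suc n) {r} {s} dr ds a with q , dq , r≈ ← dr a | p , dp , s≈ ← ds a =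
    _ , degree-+ n dq dp , λ x → trans (+-cong (r≈ x) (s≈ x))
      (solve 5 (λ ra sa t q p → (ra :+ t :* q) :+ (sa :+ t :* p) := ra :+ sa :+ t :* (q :+ p))
        refl (r a) (s a) (x - a) (q x) (p x))

  degree-scale : ∀ n b {r} → Degree< n r → Degree< n λ x → b * r x
  degree-scale zero    b dr x = trans (*-congˡ (dr x)) (zeroʳ b)
  degree-scale (suc n) b {r} dr a with q , dq , r≈ ← dr a =
    _ , degree-scale n b dq , λ x → trans (*-congˡ (r≈ x))
      (solve 4 (λ b ra t q → b :* (ra :+ t :* q) := b :* ra :+ t :* (b :* q))
        refl b (r a) (x - a) (q x))

  degree-∑ : ∀ n {m} (r : Fin m → Carrier → Carrier) → (∀ i → Degree< n (r i)) →
             Degree< n λ x → sum λ i → r i x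
  degree-∑ n {zero}  r dr = degree-0 n
  degree-∑ n {suc m} r dr = degree-+ n (dr zero) (degree-∑ n (r ∘ suc) (dr ∘ suc))

  -- The functions `x + c`: their divided difference is constantly 1.
  Monic₁ : (Carrier → Carrier) → Set (c ⊔ ℓ)
  Monic₁ l = ∀ a x → l x ≈ l a + (x - a)

  monic₁-id : Monic₁ λ x → x
  monic₁-id a x = solve 2 (λ a x → x := a :+ (x :- a)) refl a x

  monic₁-sub : ∀ b → Monic₁ λ x → x - b
  monic₁-sub b a x = solve 3 (λ a x b → x :- b := a :- b :+ (x :- a)) refl a x b

  -- Leibniz rule for divided differences: if `q` is the divided difference of `r` at `a`, then that
  -- of the product is `l x * q x + r a`, because that of `l` is 1.
  degree-monic₁* : ∀ n {l r} → Monic₁ l → Degree< n r → Degree< (suc n) λ x → l x * r x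
  degree-monic₁* zero    {l} {r} ml dr a = (λ _ → 0#) , degree-0 0 , λ x → begin
    l x * r x                        ≈⟨ trans (*-congˡ (dr x)) (zeroʳ _) ⟩
    0#                               ≈⟨ solve 2 (λ la t → con (+ 0) := la :* con (+ 0) :+ t :* con (+ 0)) refl (l a) (x - a) ⟩
    l a * 0# + (x - a) * 0#          ≈⟨ +-congʳ (*-congˡ (dr a)) ⟨
    l a * r a + (x - a) * 0#         ∎
  degree-monic₁* (suc n) {l} {r} ml dr a with q , dq , r≈ ← dr a =
    (λ x → l x * q x + r a) ,
    degree-+ (suc n) (degree-monic₁* n ml dq) (degree-constant n (r a)) , λ x → begin
    l x * r x                                       ≈⟨ *-congˡ (r≈ x) ⟩
    l x * (r a + (x - a) * q x)                     ≈⟨ solve 4 (λ l ra t q → l :* (ra :+ t :* q) := l :* ra :+ t :* (l :* q)) refl (l x) (r a) (x - a) (q x) ⟩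
    l x * r a + (x - a) * (l x * q x)               ≈⟨ +-congʳ (*-congʳ (ml a x)) ⟩
    (l a + (x - a)) * r a + (x - a) * (l x * q x)   ≈⟨ solve 4 (λ la t ra lq → (la :+ t) :* ra :+ t :* lq := la :* ra :+ t :* (lq :+ ra)) refl (l a) (x - a) (r a) (l x * q x) ⟩
    l a * r a + (x - a) * (l x * q x + r a)         ∎

  degree-^ : ∀ {j n} → j ℕ.< n → Degree< n (_^ j)
  degree-^ {zero}  {suc n} _           = degree-constant n 1#
  degree-^ {suc j} {suc n} (ℕ.s≤s j<n) = degree-monic₁* n monic₁-id (degree-^ j<n)

  degree-∏ : ∀ {n} (β : Fin n → Carrier) → Degree< (suc n) λ x → ∏ λ i → x - β i
  degree-∏ {zero}  β = degree-constant 0 1#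
  degree-∏ {suc n} β = degree-monic₁* (suc n) (monic₁-sub (β zero)) (degree-∏ (β ∘ suc))

  -- Induction on the degree bound: the divided difference at `a zero` vanishes at the remaining
  -- points, because their distances from `a zero` are units and can be cancelled.
  vanishing : ∀ n {r} → Degree< n r → (a : Fin n → Carrier) →
              (∀ i j → i ≢ j → Unit (a i - a j)) → (∀ i → r (a i) ≈ 0#) → ∀ x → r x ≈ 0#
  vanishing zero    dr a _     _  x = dr x
  vanishing (suc n) {r} dr a a-apart r≈0 x with q , dq , r≈ ← dr (a zero) = begin
    r x                                ≈⟨ r≈ x ⟩
    r (a zero) + (x - a zero) * q x    ≈⟨ +-cong (r≈0 zero) (*-congˡ q≈0) ⟩
    0# + (x - a zero) * 0#             ≈⟨ solve 1 (λ t → con (+ 0) :+ t :* con (+ 0) := con (+ 0)) refl (x - a zero) ⟩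
    0#                                 ∎
    where
    q≈0 : q x ≈ 0#
    q≈0 = vanishing n dq (a ∘ suc) (λ i j i≢j → a-apart (suc i) (suc j) (i≢j ∘ Fin.suc-injective))
      (λ i → cancel-0 (a-apart (suc i) zero λ ()) (begin
        (a (suc i) - a zero) * q (a (suc i))                ≈⟨ +-identityˡ _ ⟨
        0# + (a (suc i) - a zero) * q (a (suc i))           ≈⟨ +-congʳ (r≈0 zero) ⟨
        r (a zero) + (a (suc i) - a zero) * q (a (suc i))   ≈⟨ r≈ (a (suc i)) ⟨
        r (a (suc i))                                       ≈⟨ r≈0 (suc i) ⟩
        0#                                                  ∎)) x

-- Arithmetic of natural numbers and integers.

n∣[1+n]^m⇒n≡1 : ∀ {n} m → n ∣ suc n ℕ.^ m → n ≡ 1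
n∣[1+n]^m⇒n≡1     zero    n∣1 = ∣.∣1⇒≡1 n∣1
n∣[1+n]^m⇒n≡1 {n} (suc m) n∣  = n∣[1+n]^m⇒n≡1 m (∣.∣m+n∣m⇒∣n
  (≡.subst (n ∣_) (ℕ.+-comm (suc n ℕ.^ m) (n ℕ.* suc n ℕ.^ m)) n∣) (∣.m∣m*n (suc n ℕ.^ m)))

-- The right-hand side is a multiple of `k`, while a power of `1 + k` is 1 modulo `k`.
[1+k]^[1+k]≢2*[2k]^k : ∀ {k} → 2 ℕ.≤ k → suc k ℕ.^ suc k ≢ 2 ℕ.* (2 ℕ.* k) ℕ.^ k
[1+k]^[1+k]≢2*[2k]^k {suc k} 2≤k eq = contradiction (n∣[1+n]^m⇒n≡1 (suc (suc k))
  (≡.subst (suc k ∣_) (≡.sym eq)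
    (∣.∣n⇒∣m*n 2 (∣.∣m⇒∣m*n ((2 ℕ.* suc k) ℕ.^ k) (∣.n∣m*n 2)))))
  λ { ≡.refl → contradiction 2≤k λ { (ℕ.s≤s ()) } }

2-k≤n⇒1-n<k : ∀ {k′} p → + 2 ℤ.- + suc k′ ℤ.≤ -[1+ p ] → suc p ℕ.< k′
2-k≤n⇒1-n<k {zero}              p ()
2-k≤n⇒1-n<k {suc zero}          p ()
2-k≤n⇒1-n<k {suc (suc _)}       p (ℤ.-≤- p≤k) = ℕ.s≤s (ℕ.s≤s p≤k)

-- The characteristic polynomial and the zero of the denominator.

module CharacteristicPolynomial {c ℓ} (R : CommutativeRing c ℓ) where
  open CommutativeRing R hiding (zero)
  open IntegerCoefficients R
  open Naturals R
  open Units R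
  open import Relation.Binary.Reasoning.Setoid setoid
  open Algebra.Properties.CommutativeSemiring.Exp commutativeSemiring
  open Algebra.Properties.Semiring.Sum semiring using (*-distribˡ-sum)
    renaming (sum to ∑)

  charPoly : ℕ → Carrier → Carrier
  charPoly k x = x ^ k - ∑ {k} λ j → x ^ toℕ j

  denominator : ℕ → Carrier → Carrier
  denominator k a = natural 2 + natural (k ℕ.+ 1) * (a - natural 2)

  geometric : ∀ n x → (x - 1#) * ∑ {n} (λ j → x ^ toℕ j) ≈ x ^ n - 1#
  geometric zero    x = solve 1 (λ x → (x :- con (+ 1)) :* con (+ 0) := con (+ 1) :- con (+ 1)) refl x
  geometric (suc n) x = begin
    (x - 1#) * (1# + ∑ {n} λ j → x * x ^ toℕ j)       ≈⟨ *-congˡ (+-congˡ (*-distribˡ-sum x (λ (j : Fin n) → x ^ toℕ j))) ⟨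
    (x - 1#) * (1# + x * ∑ {n} λ j → x ^ toℕ j)       ≈⟨ solve 2 (λ x s → (x :- con (+ 1)) :* (con (+ 1) :+ x :* s) := x :- con (+ 1) :+ x :* ((x :- con (+ 1)) :* s)) refl x (∑ {n} λ j → x ^ toℕ j) ⟩
    x - 1# + x * ((x - 1#) * ∑ {n} λ j → x ^ toℕ j)   ≈⟨ +-congˡ (*-congˡ (geometric n x)) ⟩
    x - 1# + x * (x ^ n - 1#)                         ≈⟨ solve 2 (λ x p → x :- con (+ 1) :+ x :* (p :- con (+ 1)) := x :* p :- con (+ 1)) refl x (x ^ n) ⟩
    x * x ^ n - 1#                                    ∎

  [x-1]*charPoly : ∀ k x → (x - 1#) * charPoly k x ≈ x * x ^ k - (1# + 1#) * x ^ k + 1#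
  [x-1]*charPoly k x = begin
    (x - 1#) * (x ^ k - S)                 ≈⟨ solve 3 (λ x p s → (x :- con (+ 1)) :* (p :- s) := (x :- con (+ 1)) :* p :- (x :- con (+ 1)) :* s) refl x (x ^ k) S ⟩
    (x - 1#) * x ^ k - (x - 1#) * S        ≈⟨ +-congˡ (-‿cong (geometric k x)) ⟩
    (x - 1#) * x ^ k - (x ^ k - 1#)        ≈⟨ solve 2 (λ x p → (x :- con (+ 1)) :* p :- (p :- con (+ 1)) := x :* p :- con (+ 2) :* p :+ con (+ 1)) refl x (x ^ k) ⟩
    x * x ^ k - (1# + 1#) * x ^ k + 1#     ∎
    where S = ∑ {k} λ j → x ^ toℕ j

  module _ (positive-unit : ∀ n → Unit (natural (suc n))) where

    natural-apart : ∀ m n → m ≢ n → Unit (natural m - natural n)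
    natural-apart zero    zero    m≢n = contradiction ≡.refl m≢n
    natural-apart (suc m) zero    m≢n = unit-cong
      (solve 1 (λ x → x := x :- con (+ 0)) refl (natural (suc m))) (positive-unit m)
    natural-apart zero    (suc n) m≢n = unit-flip (natural-apart (suc n) zero (m≢n ∘ ≡.sym))
    natural-apart (suc m) (suc n) m≢n = unit-cong
      (solve 2 (λ x y → x :- y := (con (+ 1) :+ x) :- (con (+ 1) :+ y)) refl (natural m) (natural n))
      (natural-apart m n (m≢n ∘ ≡.cong suc))

    -- denominator k vanishes only at r = 2k / (k + 1).
    module _ {k} (2≤k : 2 ℕ.≤ k) where
      private
        N = natural (suc k)
        C = natural (2 ℕ.* k)
        N⁻¹ = proj₁ (positive-unit k)
        r = N⁻¹ * C

        N*r≈C : N * r ≈ C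
        N*r≈C = begin
          N * (N⁻¹ * C)   ≈⟨ *-assoc N N⁻¹ C ⟨
          N * N⁻¹ * C     ≈⟨ *-congʳ (proj₂ (proj₂ (positive-unit k))) ⟩
          1# * C          ≈⟨ *-identityˡ C ⟩
          C               ∎

        C≈2N-2 : C ≈ (1# + 1#) * N - (1# + 1#)
        C≈2N-2 = begin
          C                                               ≈⟨ trans (natural-* 2 k) (*-congʳ natural-2) ⟩
          (1# + 1#) * natural k                           ≈⟨ solve 1 (λ x → con (+ 2) :* x := con (+ 2) :* (con (+ 1) :+ x) :- con (+ 2)) refl (natural k) ⟩
          (1# + 1#) * (1# + natural k) - (1# + 1#)        ∎

        -- With `N * r = C`, clearing denominators in the trinomial gives
        -- `(C - 2 N) C ^ k + N ^ (k + 1)`, and `C - 2 N = -2`. The result is a difference of two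
        -- distinct natural numbers, hence a unit, and so is its factor `charPoly k r`.
        cleared : N ^ suc k * ((r - 1#) * charPoly k r) ≈
                  natural (suc k ℕ.^ suc k) - natural (2 ℕ.* (2 ℕ.* k) ℕ.^ k)
        cleared = begin
          N ^ suc k * ((r - 1#) * charPoly k r)
            ≈⟨ *-congˡ ([x-1]*charPoly k r) ⟩
          N * N ^ k * (r * r ^ k - (1# + 1#) * r ^ k + 1#)
            ≈⟨ solve 4 (λ N n r p → N :* n :* (r :* p :- con (+ 2) :* p :+ con (+ 1)) :=
                 (N :* r :- con (+ 2) :* N) :* (n :* p) :+ N :* n) refl N (N ^ k) r (r ^ k) ⟩
          (N * r - (1# + 1#) * N) * (N ^ k * r ^ k) + N * N ^ k
            ≈⟨ +-congʳ (*-cong (+-congʳ (trans N*r≈C C≈2N-2)) (trans (sym (^-distrib-* N r k)) (^-congˡ k N*r≈C))) ⟩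
          ((1# + 1#) * N - (1# + 1#) - (1# + 1#) * N) * C ^ k + N * N ^ k
            ≈⟨ solve 3 (λ N c n → (con (+ 2) :* N :- con (+ 2) :- con (+ 2) :* N) :* c :+ n :=
                 n :- con (+ 2) :* c) refl N (C ^ k) (N * N ^ k) ⟩
          N ^ suc k - (1# + 1#) * C ^ k
            ≈⟨ +-cong (natural-^ (suc k) (suc k)) (-‿cong (trans (natural-* 2 ((2 ℕ.* k) ℕ.^ k))
                 (*-cong natural-2 (natural-^ (2 ℕ.* k) k)))) ⟨
          natural (suc k ℕ.^ suc k) - natural (2 ℕ.* (2 ℕ.* k) ℕ.^ k)
            ∎

      denominator-zero : Carrier
      denominator-zero = r

      charPoly-denominator-zero : Unit (charPoly k r)
      charPoly-denominator-zero = unit-factorʳ (unit-factorʳ (unit-cong (sym cleared)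
        (natural-apart _ _ ([1+k]^[1+k]≢2*[2k]^k 2≤k))))

      -- The denominator is affine in `a` with slope `N` and zero `r`, so it equals
      -- `- (N * (r - a))`.
      denominator-unit : ∀ {a} → Unit (r - a) → Unit (denominator k a)
      denominator-unit {a} u = unit-cong (begin
        - (N * (r - a))                                    ≈⟨ solve 3 (λ N r a → :- (N :* (r :- a)) := N :* a :- N :* r) refl N r a ⟩
        N * a - N * r                                      ≈⟨ +-congˡ (-‿cong (trans N*r≈C C≈2N-2)) ⟩
        N * a - ((1# + 1#) * N - (1# + 1#))                ≈⟨ solve 2 (λ N a → N :* a :- (con (+ 2) :* N :- con (+ 2)) := con (+ 2) :+ N :* (a :- con (+ 2))) refl N a ⟩
        (1# + 1#) + N * (a - (1# + 1#))                    ≈⟨ +-cong natural-2 (*-cong (reflexive (≡.cong natural (ℕ.+-comm k 1))) (+-congˡ (-‿cong natural-2))) ⟨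
        denominator k a                                    ∎)
        (unit-neg (unit-* (positive-unit k) u))

-- The roots: cofactors, inverses and derivatives.

module Roots {c ℓ} (R : CommutativeRing c ℓ)
  (positive-unit : ∀ n → Units.Unit R (Naturals.natural R (suc n)))
  {k′} (0<k′ : 1 ℕ.≤ k′) (α : Fin (suc k′) → CommutativeRing.Carrier R)
  where

  open CommutativeRing R hiding (zero)
  open CharacteristicPolynomial R
  open IntegerCoefficients R
  open Naturals R
  open PolynomialFunctions R
  open Units R
  open import Relation.Binary.Reasoning.Setoid setoid
  open Algebra.Properties.CommutativeSemiring.Exp commutativeSemiring
  open Algebra.Properties.Semiring.Sum semiring
    using (*-distribˡ-sum; *-distribʳ-sum; ∑-comm; sum-cong-≋; sum-remove; sum-replicate-zero)
    renaming (sum to ∑)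
  open Algebra.Properties.CommutativeMonoid.Sum *-commutativeMonoid
    using () renaming (sum to ∏; sum-remove to ∏-remove)

  private
    k = suc k′

  module _ (roots : ∀ x → charPoly k x ≈ ∏ λ i → x - α i) where

    cofactor : Fin k → Carrier → Carrier
    cofactor i x = ∏ (removeAt (λ j → x - α j) i)

    charPoly-cofactor : ∀ i x → charPoly k x ≈ (x - α i) * cofactor i x
    charPoly-cofactor i x = trans (roots x) (∏-remove {i = i} λ j → x - α j)

    charPoly-root : ∀ i → charPoly k (α i) ≈ 0#
    charPoly-root i = trans (charPoly-cofactor i (α i))
      (solve 2 (λ a p → (a :- a) :* p := con (+ 0)) refl (α i) (cofactor i (α i)))

    trinomial-root : ∀ i → α i * α i ^ k - (1# + 1#) * α i ^ k + 1# ≈ 0#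
    trinomial-root i = trans (sym ([x-1]*charPoly k (α i)))
      (trans (*-congˡ (charPoly-root i)) (zeroʳ _))

    -- The constant term of `charPoly k` is -1, as the trinomial shows at 0, and it factors as
    -- `(0# - α i) * cofactor i 0#`.
    α-inverse : ∀ i → α i * cofactor i 0# ≈ 1#
    α-inverse i = begin
      α i * cofactor i 0#                         ≈⟨ solve 2 (λ a p → a :* p := (con (+ 0) :- con (+ 1)) :* ((con (+ 0) :- a) :* p)) refl (α i) (cofactor i 0#) ⟩
      (0# - 1#) * ((0# - α i) * cofactor i 0#)    ≈⟨ *-congˡ (charPoly-cofactor i 0#) ⟨
      (0# - 1#) * charPoly k 0#                   ≈⟨ [x-1]*charPoly k 0# ⟩
      0# * 0# ^ k - (1# + 1#) * (0# * 0# ^ k′) + 1#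
        ≈⟨ solve 2 (λ p q → con (+ 0) :* p :- con (+ 2) :* (con (+ 0) :* q) :+ con (+ 1) := con (+ 1)) refl (0# ^ k) (0# ^ k′) ⟩
      1#                                          ∎

    -- The inverse of `α i`. As a cofactor at 0 it is also the factor that Lagrange interpolation
    -- produces there.
    β : Fin k → Carrier
    β i = cofactor i 0#

    α-unit : ∀ i → Unit (α i)
    α-unit i = unit (β i) (α-inverse i)

    -- At the zero `r` of the denominator, the unit `charPoly k r` is the product of all `r - α j`,
    -- so each of these is a unit.
    denominator-unit′ : ∀ i → Unit (denominator k (α i))
    denominator-unit′ i = denominator-unit positive-unit (ℕ.s≤s 0<k′)
      (unit-∏ (λ j → denominator-zero positive-unit (ℕ.s≤s 0<k′) - α j) (unit-cong (roots _) (charPoly-denominator-zero positive-unit (ℕ.s≤s 0<k′))) i)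

    -- The divided difference `(x ^ n - a ^ n) / (x - a)`, defined without division so that it also
    -- has a value at `x = a`: the derivative of `x ^ n` there.
    quotient : Carrier → ℕ → Carrier → Carrier
    quotient a zero    x = 0#
    quotient a (suc n) x = x * quotient a n x + a ^ n

    quotient-degree : ∀ a n → Degree< n (quotient a n)
    quotient-degree a zero    = degree-0 0
    quotient-degree a (suc n) = degree-+ (suc n)
      (degree-monic₁* n monic₁-id (quotient-degree a n)) (degree-constant n (a ^ n))

    quotient-≈ : ∀ a n x → x ^ n ≈ a ^ n + (x - a) * quotient a n x
    quotient-≈ a zero    x = solve 2 (λ a x → con (+ 1) := con (+ 1) :+ (x :- a) :* con (+ 0)) refl a x
    quotient-≈ a (suc n) x = begin
      x * x ^ n                                          ≈⟨ *-congˡ (quotient-≈ a n x) ⟩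
      x * (a ^ n + (x - a) * quotient a n x)             ≈⟨ solve 4 (λ a x p q → x :* (p :+ (x :- a) :* q) := a :* p :+ (x :- a) :* (x :* q :+ p)) refl a x (a ^ n) (quotient a n x) ⟩
      a * a ^ n + (x - a) * (x * quotient a n x + a ^ n) ∎

    -- The factor `a` on the left avoids the exponent `n - 1`.
    quotient-derivative : ∀ a n → a * quotient a n a ≈ natural n * a ^ n
    quotient-derivative a zero    = solve 1 (λ a → a :* con (+ 0) := con (+ 0) :* con (+ 1)) refl a
    quotient-derivative a (suc n) = begin
      a * (a * quotient a n a + a ^ n)         ≈⟨ *-congˡ (+-congʳ (quotient-derivative a n)) ⟩
      a * (natural n * a ^ n + a ^ n)          ≈⟨ solve 3 (λ a n p → a :* (n :* p :+ p) := (con (+ 1) :+ n) :* (a :* p)) refl a (natural n) (a ^ n) ⟩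
      (1# + natural n) * (a * a ^ n)           ∎

    -- x - a is not cancelable at x = a, so r is first shown to vanish at
    -- a + 1, a + 2, ….
    cancel-[x-a] : ∀ n {r} → Degree< n r → ∀ a → (∀ x → (x - a) * r x ≈ 0#) → r a ≈ 0#
    cancel-[x-a] n {r} dr a [x-a]r≈0 = vanishing n dr (λ i → a + natural (suc (toℕ i)))
      (λ i j i≢j → unit-cong
        (solve 3 (λ a x y → x :- y := (a :+ x) :- (a :+ y)) refl a (natural (suc (toℕ i))) (natural (suc (toℕ j))))
        (natural-apart positive-unit _ _ (i≢j ∘ Fin.toℕ-injective ∘ ℕ.suc-injective)))
      (λ i → cancel-0 (unit-cong
        (solve 2 (λ a x → x := (a :+ x) :- a) refl a (natural (suc (toℕ i)))) (positive-unit (toℕ i)))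
        ([x-a]r≈0 _))
      a

    cofactor-degree : ∀ i → Degree< k (cofactor i)
    cofactor-degree i = degree-∏ (α ∘ punchIn i)

    -- The derivative at α i of (x - 1) charPoly k x = x ^ (k + 1) - 2 x ^ k + 1,
    -- computed from either side and multiplied by α i.
    cofactor-denominator : ∀ i → α i * ((α i - 1#) * cofactor i (α i)) ≈
                           α i ^ k * denominator k (α i)
    cofactor-denominator i = begin
      a * ((a - 1#) * P a)
        ≈⟨ solve 3 (λ a u v → a :* u := a :* v :+ a :* (u :+ con (ℤ.- + 1) :* v)) refl a ((a - 1#) * P a) (G a) ⟩
      a * G a + a * ((a - 1#) * P a + - 1# * G a)
        ≈⟨ +-congˡ (*-congˡ derivatives) ⟩
      a * G a + a * 0#
        ≈⟨ solve 3 (λ a q p → a :* ((a :- con (+ 2)) :* q :+ p) :+ a :* con (+ 0) :=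
             (a :- con (+ 2)) :* (a :* q) :+ a :* p) refl a (quotient a k a) (a ^ k) ⟩
      (a - (1# + 1#)) * (a * quotient a k a) + a * a ^ k
        ≈⟨ +-congʳ (*-congˡ (quotient-derivative a k)) ⟩
      (a - (1# + 1#)) * (natural k * a ^ k) + a * a ^ k
        ≈⟨ solve 3 (λ a n p → (a :- con (+ 2)) :* (n :* p) :+ a :* p :=
             p :* (con (+ 2) :+ (con (+ 1) :+ n) :* (a :- con (+ 2)))) refl a (natural k) (a ^ k) ⟩
      a ^ k * ((1# + 1#) + natural (suc k) * (a - (1# + 1#)))
        ≈⟨ *-congˡ (+-cong natural-2 (*-cong (reflexive (≡.cong natural (ℕ.+-comm k 1))) (+-congˡ (-‿cong natural-2)))) ⟨
      a ^ k * denominator k a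
        ∎
      where
      a = α i
      P = cofactor i

      -- `G` is the divided difference of the trinomial at its root `a`, so `(x - a) * G x` equals
      -- `(x - a) * ((x - 1#) * P x)` for every `x`.
      G : Carrier → Carrier
      G x = (x - (1# + 1#)) * quotient a k x + a ^ k

      derivatives : (a - 1#) * P a + - 1# * G a ≈ 0#
      derivatives = cancel-[x-a] (suc k)
        (degree-+ (suc k) (degree-monic₁* k (monic₁-sub 1#) (cofactor-degree i))
          (degree-scale (suc k) (- 1#) (degree-+ (suc k)
            (degree-monic₁* k (monic₁-sub (1# + 1#)) (quotient-degree a k))
            (degree-constant k (a ^ k)))))
        a λ x → begin
        (x - a) * ((x - 1#) * P x + - 1# * G x)
          ≈⟨ solve 5 (λ x a p q n → (x :- a) :* ((x :- con (+ 1)) :* p :+ con (ℤ.- + 1) :* ((x :- con (+ 2)) :* q :+ n)) :=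
               (x :- con (+ 1)) :* ((x :- a) :* p) :- ((x :- con (+ 2)) :* (n :+ (x :- a) :* q) :+ con (+ 1))
                 :+ (a :* n :- con (+ 2) :* n :+ con (+ 1))) refl x a (P x) (quotient a k x) (a ^ k) ⟩
        (x - 1#) * ((x - a) * P x) - ((x - (1# + 1#)) * (a ^ k + (x - a) * quotient a k x) + 1#)
          + (a * a ^ k - (1# + 1#) * a ^ k + 1#)
          ≈⟨ +-cong (+-cong (*-congˡ (charPoly-cofactor i x)) (-‿cong (+-congʳ (*-congˡ (quotient-≈ a k x))))) (sym (trinomial-root i)) ⟨
        (x - 1#) * charPoly k x - ((x - (1# + 1#)) * x ^ k + 1#) + 0#
          ≈⟨ +-congʳ (+-congʳ ([x-1]*charPoly k x)) ⟩
        x * x ^ k - (1# + 1#) * x ^ k + 1# - ((x - (1# + 1#)) * x ^ k + 1#) + 0#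
          ≈⟨ solve 2 (λ x p → x :* p :- con (+ 2) :* p :+ con (+ 1) :- ((x :- con (+ 2)) :* p :+ con (+ 1)) :+ con (+ 0)
               := con (+ 0)) refl x (x ^ k) ⟩
        0# ∎

    α[α-1]cofactor-unit : ∀ i → Unit (α i * ((α i - 1#) * cofactor i (α i)))
    α[α-1]cofactor-unit i = unit-cong (sym (cofactor-denominator i))
      (unit-* (unit-^ (α-unit i) k) (denominator-unit′ i))

    cofactor-unit : ∀ i → Unit (cofactor i (α i))
    cofactor-unit i = unit-factorʳ (unit-factorʳ (α[α-1]cofactor-unit i))

    -- Simplicity of the roots and Lagrange interpolation.

    cofactor-zero : ∀ {i j} → i ≢ j → cofactor i (α j) ≈ 0#
    cofactor-zero {i} {j} i≢j = ∏-zero (λ l → α j - α (punchIn i l)) (punchOut i≢j) (begin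
      α j - α (punchIn i (punchOut i≢j))   ≡⟨ ≡.cong (λ l → α j - α l) (Fin.punchIn-punchOut i≢j) ⟩
      α j - α j                            ≈⟨ -‿inverseʳ (α j) ⟩
      0#                                   ∎)
      where
      ∏-zero : ∀ {n} (t : Fin n → Carrier) l → t l ≈ 0# → ∏ t ≈ 0#
      ∏-zero {suc n} t l tl≈0 = trans (∏-remove {i = l} t) (trans (*-congʳ tl≈0) (zeroˡ _))

    -- The difference is a factor of the unit `cofactor i (α i)`; thus the roots are shown to be
    -- simple.
    roots-apart : ∀ i j → i ≢ j → Unit (α i - α j)
    roots-apart i j i≢j = unit-cong
      (reflexive (≡.cong (λ l → α i - α l) (Fin.punchIn-punchOut i≢j)))
      (unit-∏ (λ l → α i - α (punchIn i l)) (cofactor-unit i) (punchOut i≢j))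

    -- The Lagrange weight, the inverse of the derivative of `charPoly k` at `α i`.
    w : Fin k → Carrier
    w i = proj₁ (cofactor-unit i)

    ∑-zero : ∀ {n} {t : Fin n → Carrier} → (∀ i → t i ≈ 0#) → ∑ t ≈ 0#
    ∑-zero {n} t≈0 = trans (sum-cong-≋ t≈0) (sum-replicate-zero n)

    ∑-single : ∀ {n} (t : Fin n → Carrier) m → (∀ i → i ≢ m → t i ≈ 0#) → ∑ t ≈ t m
    ∑-single {suc n} t m t≈0 = trans (sum-remove {i = m} t)
      (trans (+-congˡ (∑-zero λ i → t≈0 (punchIn m i) (Fin.punchInᵢ≢i m i))) (+-identityʳ (t m)))

    -- Lagrange interpolation of x ^ j at the roots, evaluated at 0.
    interpolation : ∀ {j} → j ℕ.< k → ∑ (λ i → w i * α i ^ j * β i) ≈ 0# ^ j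
    interpolation {j} j<k = begin
      ∑ (λ i → w i * α i ^ j * cofactor i 0#)            ≈⟨ solve 2 (λ s p → s := p :- (p :+ con (ℤ.- + 1) :* s)) refl (L 0#) (0# ^ j) ⟩
      0# ^ j - (0# ^ j + - 1# * L 0#)                    ≈⟨ +-congˡ (-‿cong (vanishing k degree α roots-apart agrees 0#)) ⟩
      0# ^ j - 0#                                        ≈⟨ solve 1 (λ p → p :- con (+ 0) := p) refl (0# ^ j) ⟩
      0# ^ j                                             ∎
      where
      L : Carrier → Carrier
      L x = ∑ λ i → w i * α i ^ j * cofactor i x

      degree : Degree< k λ x → x ^ j + - 1# * L x
      degree = degree-+ k (degree-^ j<k) (degree-scale k (- 1#)
        (degree-∑ k (λ i x → w i * α i ^ j * cofactor i x)
          λ i → degree-scale k (w i * α i ^ j) (cofactor-degree i)))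

      agrees : ∀ m → α m ^ j + - 1# * L (α m) ≈ 0#
      agrees m = begin
        α m ^ j + - 1# * L (α m)
          ≈⟨ +-congˡ (*-congˡ (∑-single (λ i → w i * α i ^ j * cofactor i (α m)) m λ i i≢m → trans (*-congˡ (cofactor-zero i≢m)) (zeroʳ _))) ⟩
        α m ^ j + - 1# * (w m * α m ^ j * cofactor m (α m))
          ≈⟨ solve 3 (λ p w c → p :+ con (ℤ.- + 1) :* (w :* p :* c) := p :- (w :* c) :* p) refl (α m ^ j) (w m) (cofactor m (α m)) ⟩
        α m ^ j - w m * cofactor m (α m) * α m ^ j
          ≈⟨ +-congˡ (-‿cong (*-congʳ (proj₁ (proj₂ (cofactor-unit m))))) ⟩
        α m ^ j - 1# * α m ^ j
          ≈⟨ solve 1 (λ p → p :- con (+ 1) :* p := con (+ 0)) refl (α m ^ j) ⟩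
        0# ∎

    -- The Binet sum: initial values, recurrence and comparison with the sequence.

    W : Fin k → Carrier
    W i = (α i - 1#) * proj₁ (denominator-unit′ i)

    -- This is `cofactor-denominator` divided by the denominator and by the cofactor. The factor
    -- `α i` on the left avoids the exponent `k - 1`.
    α*W : ∀ i → α i * W i ≈ α i ^ k * w i
    α*W i = begin
      a * ((a - 1#) * d⁻¹)                      ≈⟨ solve 1 (λ x → x := x :* con (+ 1)) refl (a * ((a - 1#) * d⁻¹)) ⟩
      a * ((a - 1#) * d⁻¹) * 1#                 ≈⟨ *-congˡ (proj₂ (proj₂ (cofactor-unit i))) ⟨
      a * ((a - 1#) * d⁻¹) * (P * w i)          ≈⟨ solve 5 (λ a b d p w → a :* (b :* d) :* (p :* w) := a :* (b :* p) :* (d :* w)) refl a (a - 1#) d⁻¹ P (w i) ⟩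
      a * ((a - 1#) * P) * (d⁻¹ * w i)          ≈⟨ *-congʳ (cofactor-denominator i) ⟩
      a ^ k * d * (d⁻¹ * w i)                   ≈⟨ solve 4 (λ p d e w → p :* d :* (e :* w) := p :* w :* (d :* e)) refl (a ^ k) d d⁻¹ (w i) ⟩
      a ^ k * w i * (d * d⁻¹)                   ≈⟨ *-congˡ (proj₂ (proj₂ (denominator-unit′ i))) ⟩
      a ^ k * w i * 1#                          ≈⟨ *-identityʳ _ ⟩
      a ^ k * w i                               ∎
      where
      a = α i
      P = cofactor i a
      d = denominator k a
      d⁻¹ = proj₁ (denominator-unit′ i)

    α^n*β^n : ∀ i n → α i ^ n * β i ^ n ≈ 1#
    α^n*β^n i n = begin
      α i ^ n * β i ^ n   ≈⟨ ^-distrib-* (α i) (β i) n ⟨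
      (α i * β i) ^ n     ≈⟨ ^-congˡ n (α-inverse i) ⟩
      1# ^ n              ≈⟨ 1^n n ⟩
      1#                  ∎
      where
      1^n : ∀ n → 1# ^ n ≈ 1#
      1^n zero    = refl
      1^n (suc n) = trans (*-identityˡ _) (1^n n)

    -- Since `β i - 1# = - (β i * (α i - 1#))`, this follows from the units already found; it
    -- permits division in the geometric series of `β i`.
    β-1-unit : ∀ i → Unit (β i - 1#)
    β-1-unit i = unit-cong (begin
      - (β i * (α i - 1#))   ≈⟨ solve 2 (λ a b → :- (b :* (a :- con (+ 1))) := b :- a :* b) refl (α i) (β i) ⟩
      β i - α i * β i        ≈⟨ +-congˡ (-‿cong (α-inverse i)) ⟩
      β i - 1#               ∎)
      (unit-neg (unit-* (unit-factorʳ (unit-cong (sym (α-inverse i)) unit-1))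
        (unit-factorˡ (unit-factorʳ (α[α-1]cofactor-unit i)))))

    -- The trinomial equation of `α i`, divided by `α i ^ k`.
    β^k : ∀ i → β i ^ k ≈ (1# + 1#) - α i
    β^k i = begin
      b ^ k
        ≈⟨ solve 2 (λ a b → b := con (+ 2) :- a :+ ((a :- con (+ 2)) :* con (+ 1) :+ b)) refl a (b ^ k) ⟩
      (1# + 1#) - a + ((a - (1# + 1#)) * 1# + b ^ k)
        ≈⟨ +-congˡ (+-congʳ (*-congˡ (α^n*β^n i k))) ⟨
      (1# + 1#) - a + ((a - (1# + 1#)) * (a ^ k * b ^ k) + b ^ k)
        ≈⟨ solve 3 (λ a p b → con (+ 2) :- a :+ ((a :- con (+ 2)) :* (p :* b) :+ b) :=
             con (+ 2) :- a :+ (a :* p :- con (+ 2) :* p :+ con (+ 1)) :* b) refl a (a ^ k) (b ^ k) ⟩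
      (1# + 1#) - a + (a * a ^ k - (1# + 1#) * a ^ k + 1#) * b ^ k
        ≈⟨ +-congˡ (*-congʳ (trinomial-root i)) ⟩
      (1# + 1#) - a + 0# * b ^ k
        ≈⟨ solve 2 (λ a b → con (+ 2) :- a :+ con (+ 0) :* b := con (+ 2) :- a) refl a (b ^ k) ⟩
      (1# + 1#) - a
        ∎
      where
      a = α i
      b = β i

    -- The characteristic equation divided by `α i ^ (k - 1)`: in this form it gives the recurrence
    -- in terms of earlier indices only.
    α≈∑β^j : ∀ i → α i ≈ ∑ {k} λ j → β i ^ toℕ j
    α≈∑β^j i = cancel (β-1-unit i) (begin
      (β i - 1#) * α i                          ≈⟨ solve 2 (λ a b → (b :- con (+ 1)) :* a := a :* b :- a) refl (α i) (β i) ⟩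
      α i * β i - α i                           ≈⟨ +-congʳ (α-inverse i) ⟩
      1# - α i                                  ≈⟨ solve 1 (λ a → con (+ 1) :- a := con (+ 2) :- a :- con (+ 1)) refl (α i) ⟩
      (1# + 1#) - α i - 1#                      ≈⟨ +-congʳ (β^k i) ⟨
      β i ^ k - 1#                              ≈⟨ geometric k (β i) ⟨
      (β i - 1#) * ∑ {k} (λ j → β i ^ toℕ j)    ∎)

    α^k≈∑α^j : ∀ i → α i ^ k ≈ ∑ {k} λ j → α i ^ toℕ j
    α^k≈∑α^j i = begin
      α i ^ k                         ≈⟨ solve 2 (λ p s → p := p :- s :+ s) refl (α i ^ k) S ⟩
      α i ^ k - S + S                 ≈⟨ +-congʳ (charPoly-root i) ⟩
      0# + S                          ≈⟨ +-identityˡ S ⟩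
      S                               ∎
      where S = ∑ {k} λ j → α i ^ toℕ j

    -- The right-hand side at index `m + 1 - j`, with two natural exponents in place of the integer
    -- `m - j`, so that its arguments match those of `fibBack`.
    binet : ℕ → ℕ → Carrier
    binet m j = ∑ λ i → W i * (α i ^ m * β i ^ j)

    W≈ : ∀ i → W i ≈ w i * α i ^ k * β i
    W≈ i = begin
      W i                    ≈⟨ *-identityˡ (W i) ⟨
      1# * W i               ≈⟨ *-congʳ (α-inverse i) ⟨
      α i * β i * W i        ≈⟨ solve 3 (λ a b w → a :* b :* w := a :* w :* b) refl (α i) (β i) (W i) ⟩
      α i * W i * β i        ≈⟨ *-congʳ (trans (α*W i) (*-comm _ _)) ⟩
      w i * α i ^ k * β i    ∎

    -- The power `α i ^ k` in `W≈` lies just outside the range of `interpolation`, so the root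
    -- equation first replaces it by lower powers. Interpolation then leaves the sum of all `0# ^ j`
    -- with `j < k`, which is 1.
    binet-0-0 : binet 0 0 ≈ 1#
    binet-0-0 = begin
      ∑ (λ i → W i * (1# * 1#))                                  ≈⟨ sum-cong-≋ summand ⟩
      ∑ (λ i → ∑ {k} λ j → w i * α i ^ toℕ j * β i)              ≈⟨ ∑-comm (λ i (j : Fin k) → w i * α i ^ toℕ j * β i) ⟩
      ∑ {k} (λ j → ∑ λ i → w i * α i ^ toℕ j * β i)              ≈⟨ sum-cong-≋ (λ j → interpolation (Fin.toℕ<n j)) ⟩
      1# + ∑ {k′} (λ j → 0# * 0# ^ toℕ j)                        ≈⟨ +-congˡ (∑-zero λ j → zeroˡ (0# ^ toℕ {k′} j)) ⟩
      1# + 0#                                                    ≈⟨ +-identityʳ 1# ⟩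
      1#                                                         ∎
      where
      summand : ∀ i → W i * (1# * 1#) ≈ ∑ {k} λ j → w i * α i ^ toℕ j * β i
      summand i = begin
        W i * (1# * 1#)                              ≈⟨ solve 1 (λ w → w :* (con (+ 1) :* con (+ 1)) := w) refl (W i) ⟩
        W i                                          ≈⟨ W≈ i ⟩
        w i * α i ^ k * β i                          ≈⟨ *-congʳ (*-congˡ (α^k≈∑α^j i)) ⟩
        w i * ∑ {k} (λ j → α i ^ toℕ j) * β i        ≈⟨ *-congʳ (*-distribˡ-sum (w i) λ (j : Fin k) → α i ^ toℕ j) ⟩
        ∑ {k} (λ j → w i * α i ^ toℕ j) * β i        ≈⟨ *-distribʳ-sum (β i) (λ (j : Fin k) → w i * α i ^ toℕ j) ⟩
        ∑ {k} (λ j → w i * α i ^ toℕ j * β i)        ∎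

    binet-0-suc : ∀ {j} → j ℕ.< k′ → binet 0 (suc j) ≈ 0#
    -- Here `k = suc (suc j + e)`, so cancelling `β i ^ suc j` against `α i ^ k` leaves the exponent
    -- `suc e`. It lies between 1 and `k - 1`, where interpolation gives 0.
    binet-0-suc {j} j<k′ with e , ≡.refl ← ℕ.m≤n⇒∃[o]m+o≡n j<k′ = begin
      ∑ (λ i → W i * (1# * β i ^ suc j))           ≈⟨ sum-cong-≋ summand ⟩
      ∑ (λ i → w i * α i ^ suc e * β i)            ≈⟨ interpolation (ℕ.s≤s (ℕ.s≤s (ℕ.m≤n+m e j))) ⟩
      0# * 0# ^ e                                  ≈⟨ zeroˡ _ ⟩
      0#                                           ∎
      where
      summand : ∀ i → W i * (1# * β i ^ suc j) ≈ w i * α i ^ suc e * β i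
      summand i = begin
        W i * (1# * β i ^ suc j)
          ≈⟨ *-congʳ (W≈ i) ⟩
        w i * α i ^ suc (suc j ℕ.+ e) * β i * (1# * β i ^ suc j)
          ≈⟨ *-congʳ (*-congʳ (*-congˡ (*-congˡ (^-homo-* (α i) (suc j) e)))) ⟩
        w i * (α i * (α i ^ suc j * α i ^ e)) * β i * (1# * β i ^ suc j)
          ≈⟨ solve 6 (λ w a p q b r → w :* (a :* (p :* q)) :* b :* (con (+ 1) :* r) :=
               w :* (a :* q) :* b :* (p :* r)) refl (w i) (α i) (α i ^ suc j) (α i ^ e) (β i) (β i ^ suc j) ⟩
        w i * (α i * α i ^ e) * β i * (α i ^ suc j * β i ^ suc j)
          ≈⟨ trans (*-congˡ (α^n*β^n i (suc j))) (*-identityʳ _) ⟩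
        w i * α i ^ suc e * β i
          ∎

    binet-suc-suc : ∀ m j → binet (suc m) (suc j) ≈ binet m j
    binet-suc-suc m j = sum-cong-≋ λ i → begin
      W i * (α i * α i ^ m * (β i * β i ^ j))      ≈⟨ solve 5 (λ w a p b q → w :* (a :* p :* (b :* q)) := a :* b :* (w :* (p :* q))) refl (W i) (α i) (α i ^ m) (β i) (β i ^ j) ⟩
      α i * β i * (W i * (α i ^ m * β i ^ j))      ≈⟨ *-congʳ (α-inverse i) ⟩
      1# * (W i * (α i ^ m * β i ^ j))             ≈⟨ *-identityˡ _ ⟩
      W i * (α i ^ m * β i ^ j)                    ∎

    binet-suc-0 : ∀ m → binet (suc m) 0 ≈ ∑ {k} λ j → binet m (toℕ j)
    binet-suc-0 m = trans (sum-cong-≋ summand)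
      (∑-comm λ i (j : Fin k) → W i * (α i ^ m * β i ^ toℕ j))
      where
      summand : ∀ i → W i * (α i ^ suc m * 1#) ≈ ∑ {k} λ j → W i * (α i ^ m * β i ^ toℕ j)
      summand i = begin
        W i * (α i * α i ^ m * 1#)                          ≈⟨ solve 3 (λ w a p → w :* (a :* p :* con (+ 1)) := w :* (p :* a)) refl (W i) (α i) (α i ^ m) ⟩
        W i * (α i ^ m * α i)                               ≈⟨ *-congˡ (*-congˡ (α≈∑β^j i)) ⟩
        W i * (α i ^ m * ∑ {k} (λ j → β i ^ toℕ j))         ≈⟨ *-congˡ (*-distribˡ-sum (α i ^ m) λ (j : Fin k) → β i ^ toℕ j) ⟩
        W i * ∑ {k} (λ j → α i ^ m * β i ^ toℕ j)           ≈⟨ *-distribˡ-sum (W i) (λ (j : Fin k) → α i ^ m * β i ^ toℕ j) ⟩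
        ∑ {k} (λ j → W i * (α i ^ m * β i ^ toℕ j))         ∎

    -- The case of index `- j`, where the exponent `n - 1` is `- (j + 1)`; the bound on `j` says
    -- that the index is at least `2 - k`.
    fib-nonPositive : (α≠0 : ∀ i → Unit (α i)) → ∀ {j} → j ℕ.< k′ →
                      0# ≈ ∑ λ i → W i * proj₁ (α≠0 i) ^ suc j
    fib-nonPositive α≠0 {j} j<k′ = trans (sym (binet-0-suc j<k′)) (sum-cong-≋ λ i → *-congˡ {W i}
      (trans (*-identityˡ _) (^-congˡ (suc j) (inverse-unique refl (α-unit i) (α≠0 i)))))

    -- Both sides obey the same recursion on `m`. The bound on `j` keeps the index `1 - j` reached
    -- at `m = 0` within the initial values.
    fibBack≈binet : ∀ m {j} → j ℕ.< k → natural (fibBack k m j) ≈ binet m j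
    fibBack≈binet zero    {zero}  _            = trans natural-1 (sym binet-0-0)
    fibBack≈binet zero    {suc j} (ℕ.s≤s j<k′) = sym (binet-0-suc j<k′)
    fibBack≈binet (suc m) {zero}  _            = begin
      natural (fibBack k (suc m) 0)                 ≈⟨ natural-∑ {k} (λ j → fibBack k m (toℕ j)) ⟩
      ∑ {k} (λ j → natural (fibBack k m (toℕ j)))   ≈⟨ sum-cong-≋ (λ j → fibBack≈binet m (Fin.toℕ<n j)) ⟩
      ∑ {k} (λ j → binet m (toℕ j))                 ≈⟨ binet-suc-0 m ⟨
      binet (suc m) 0                               ∎
    fibBack≈binet (suc m) {suc j} (ℕ.s≤s j<k′) =
      trans (fibBack≈binet m (ℕ.m<n⇒m<1+n j<k′)) (sym (binet-suc-suc m j))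

    fib-power : ∀ (α≠0 : ∀ i → Unit (α i)) n → + 2 ℤ.- + k ℤ.≤ n →
                natural (F k n) ≈ ∑ λ i → W i * power (α i) (n ℤ.- + 1) (α≠0 i)
    fib-power α≠0 (+ suc m) _ = trans (fibBack≈binet m (ℕ.s≤s ℕ.z≤n))
      (sum-cong-≋ λ i → *-congˡ {W i} (*-identityʳ (α i ^ m)))
    fib-power α≠0 (+ zero)  _ = fib-nonPositive α≠0 0<k′
    fib-power α≠0 -[1+ p ] 2-k≤n =
      -- The exponent `-[1+ p ] - 1` computes to `-[1+ suc (p + 0) ]`, so the bound is needed for
      -- `suc (p + 0)`.
      fib-nonPositive α≠0 (≡.subst (λ p → suc p ℕ.< k′) (≡.sym (ℕ.+-identityʳ p)) (2-k≤n⇒1-n<k p 2-k≤n))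

    -- The family `t` stands for the summands, so that a concrete ring can supply its own form of
    -- them with a separate proof of equality.
    fib-formula : ∀ (α≠0 : ∀ i → Unit (α i)) (d≠0 : ∀ i → Unit (denominator k (α i))) n →
      + 2 ℤ.- + k ℤ.≤ n → ∀ t → (∀ i → t i ≡ binet-term n (α≠0 i) (proj₁ (d≠0 i))) →
      natural (F k n) ≈ ∑ t
    fib-formula α≠0 d≠0 n 2-k≤n t t≡ = begin
      natural (F k n)                                         ≈⟨ fib-power α≠0 n 2-k≤n ⟩
      ∑ (λ i → W i * power (α i) (n ℤ.- + 1) (α≠0 i))         ≈⟨ sum-cong-≋ W-independent ⟩
      ∑ (λ i → binet-term n (α≠0 i) (proj₁ (d≠0 i)))          ≈⟨ sum-cong-≋ (λ i → reflexive (t≡ i)) ⟨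
      ∑ t                                                     ∎
      where
      W-independent : ∀ i → W i * power (α i) (n ℤ.- + 1) (α≠0 i) ≈ binet-term n (α≠0 i) (proj₁ (d≠0 i))
      W-independent i = *-congʳ (*-congˡ (inverse-unique refl (denominator-unit′ i) (d≠0 i)))

-- Specialisation to the complex numbers.

open import Defs

rational : ℕ → ℚ
rational zero    = 0ℚ
rational (suc n) = 1ℚ ℚ.+ rational n

rational-nonNegative : ∀ n → ℚ.NonNegative (rational n)
rational-nonNegative zero    = _
rational-nonNegative (suc n) = ℚ.nonNeg+nonNeg⇒nonNeg 1ℚ (rational n) {{rational-nonNegative n}}

rational-suc-nonZero : ∀ n → ℚ.NonZero (rational (suc n))
rational-suc-nonZero n = ℚ.pos⇒nonZero (rational (suc n))
  {{ℚ.pos+nonNeg⇒pos 1ℚ (rational n) {{rational-nonNegative n}}}}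

re-fromℕ : ∀ n m → seq (proj₁ (fromℕ n)) m ≡ rational n
re-fromℕ zero    m = ≡.refl
re-fromℕ (suc n) m = ≡.cong (1ℚ ℚ.+_) (re-fromℕ n m)

im-fromℕ : ∀ n m → seq (proj₂ (fromℕ n)) m ≡ 0ℚ
im-fromℕ zero    m = ≡.refl
im-fromℕ (suc n) m = ≡.trans (≡.cong (0ℚ ℚ.+_) (im-fromℕ n m)) (ℚ.+-identityˡ 0ℚ)

-- Both parts of `fromℕ (suc n)` are constant sequences, so the rational reciprocal, as a constant
-- real part, gives an inverse term by term.
fromℕ-suc-unit : ∀ n → IsUnit (fromℕ (suc n))
fromℕ-suc-unit n = Units.unit ℂ-commutativeRing {x} y
  ( ≗⇒≈ᴿ (proj₁ (x * y)) (proj₁ 1#) re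
  , ≗⇒≈ᴿ (proj₂ (x * y)) (proj₂ 1#) im )
  where
  instance _ = rational-suc-nonZero n
  p = ℚ.1/ rational (suc n)
  x = fromℕ (suc n)
  y = fromℚ p , fromℚ 0ℚ
  re : ∀ m → seq (proj₁ x) m ℚ.* p ℚ.- seq (proj₂ x) m ℚ.* 0ℚ ≡ 1ℚ
  re m = ≡.trans
    (≡.cong₂ (λ a b → a ℚ.* p ℚ.- b ℚ.* 0ℚ) (re-fromℕ (suc n) m) (im-fromℕ (suc n) m))
    (≡.cong (ℚ._- 0ℚ ℚ.* 0ℚ) (ℚ.*-inverseʳ (rational (suc n))))
  im : ∀ m → seq (proj₁ x) m ℚ.* 0ℚ ℚ.+ seq (proj₂ x) m ℚ.* p ≡ 0ℚ
  im m = ≡.cong₂ ℚ._+_ (ℚ.*-zeroʳ (seq (proj₁ x) m))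
    (≡.trans (≡.cong (ℚ._* p) (im-fromℕ (suc n) m)) (ℚ.*-zeroˡ p))

module ℂ = CommutativeRing ℂ-commutativeRing

-≡ : ∀ x y → x - y ≡ x ℂ.- y
-≡ x y = ≡.refl

*≡ : ∀ x y → x * y ≡ x ℂ.* y
*≡ x y = ≡.refl

/≡ : ∀ x y (u : IsUnit y) → x / y [ u ] ≡ x ℂ.* proj₁ u
/≡ x y u = ≡.refl

^ℤ≡ : ∀ x n (u : IsUnit x) → x ^ℤ n [ u ] ≡ Units.power ℂ-commutativeRing x n u
^ℤ≡ x (+ n)    u = ≡.refl
^ℤ≡ x -[1+ n ] u = ≡.refl

-- Unfolding a compound expression over ℂ makes Agda compare the Cauchy proofs
-- inside it, which is infeasible.  Hence the intermediate results o, x, q and p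
-- are variables here, so that operations are unfolded one at a time.
binet-term-ℂ : ∀ a d (d≠0 : IsUnit d) n (a≠0 : IsUnit a) {o x q p} →
  o ≡ 1# → x ≡ a - o → q ≡ x / d [ d≠0 ] → p ≡ a ^ℤ (n ℤ.- + 1) [ a≠0 ] →
  q * p ≡ Units.binet-term ℂ-commutativeRing {a} n a≠0 (proj₁ d≠0)
binet-term-ℂ a d d≠0 n a≠0 {o} {x} {q} {p} o≡ x≡ q≡ p≡ =
  Units.binet-term-≡ ℂ-commutativeRing {a} n a≠0 (proj₁ d≠0) {o} {x} {q} {p} {q * p}
    o≡ (≡.trans x≡ (-≡ a o)) (≡.trans q≡ (/≡ x d d≠0)) (≡.trans p≡ (^ℤ≡ a (n ℤ.- + 1) a≠0)) (*≡ q p)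

module _ {k′} (0<k′ : 1 ℕ.≤ k′) (α : Fin (suc k′) → ℂ) (roots : AreRoots (suc k′) α)
  (α≠0 : ∀ i → IsUnit (α i)) (d≠0 : ∀ i → IsUnit (denominator (suc k′) (α i)))
  (n : ℤ) (2-k≤n : + 2 ℤ.- + suc k′ ℤ.≤ n)
  where

  fib-formula-ℂ : ∀ t →
    (∀ i → t i ≡ Units.binet-term ℂ-commutativeRing {α i} n (α≠0 i) (proj₁ (d≠0 i))) →
    fromℕ (F (suc k′) n) ≈ ∑ t
  fib-formula-ℂ = Roots.fib-formula ℂ-commutativeRing fromℕ-suc-unit 0<k′ α roots α≠0 d≠0 n 2-k≤n

  binet-ℂ : fromℕ (F (suc k′) n) ≈
    ∑ (λ i → (α i - 1#) / denominator (suc k′) (α i) [ d≠0 i ] * (α i ^ℤ (n ℤ.- + 1) [ α≠0 i ]))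
  binet-ℂ =
    -- The let keeps the summand from being inferred by unfolding the goal.
    let formula = fib-formula-ℂ _ λ i → binet-term-ℂ (α i) (denominator (suc k′) (α i))
          (d≠0 i) n (α≠0 i) ≡.refl ≡.refl ≡.refl ≡.refl
    in formula

theorem1 : (k : ℕ) → 2 ℕ.≤ k →
    (α : Fin k → ℂ) → AreRoots k α →
    Σ[ α≠0 ∈ (∀ i → IsUnit (α i)) ]
    Σ[ d≠0 ∈ (∀ i → IsUnit (denominator k (α i))) ]
    ((n : ℤ) → + 2 ℤ.- + k ℤ.≤ n →
    fromℕ (F k n) ≈
    ∑ (λ i → (α i - 1#) / denominator k (α i) [ d≠0 i ] * (α i ^ℤ (n ℤ.- + 1) [ α≠0 i ])))
theorem1 (suc k′) (ℕ.s≤s 0<k′) α roots =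
  α-unit roots , denominator-unit′ roots ,
  binet-ℂ 0<k′ α roots (α-unit roots) (denominator-unit′ roots)
  where open Roots ℂ-commutativeRing fromℕ-suc-unit 0<k′ α
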